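{- Let $G$ be a graph. If $6 \leq \chi(G) = \left\lfloor \frac{\theta(G)}{2} \right\rfloor + 1$, then $G$ contains the complete graph $K_{\chi(G)}$ as a subgraph.
   Context: Graphs are finite and simple, $\chi(G)$ is the chromatic number of $G$ and $d(x)$ is the degree of a vertex $x$. The Ore-degree of an edge $xy$ in a graph $G$ is $\theta(xy) = d(x) + d(y)$. The Ore-degree of a graph $G$ is $\theta(G) = \max_{xy \in E(G)} \theta(xy)$. -}

module Defs where

open import Data.Fin using (Fin; finToFun; funToFin)
open import Data.Fin.Properties using (_≟_; all?; any?; finToFun-funToFin)
open import Data.List using (List; allFin; cartesianProduct; filter; length; map; upTo)
open import Data.List.Extrema.Nat using (max; min)
open import Data.Nat using (ℕ; _+_; _^_)
open import Data.Product using (_×_; _,_; ∃; ∃-syntax; uncurry)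
open import Function using (_∘_)
open import Function.Definitions using (Injective)
open import Relation.Binary using (Decidable; Irreflexive; Rel; Symmetric)
open import Relation.Binary.PropositionalEquality using (_≡_; _≢_; refl; subst₂; sym)
open import Relation.Nullary using (Dec; ¬?; _→-dec_)
open import Relation.Nullary.Decidable using (map′)
open import Level using (0ℓ)

record Graph : Set₁ where
  field
    order  : ℕ
    Adj    : Rel (Fin order) 0ℓ
    adj?   : Decidable Adj
    symm   : Symmetric Adj
    irrefl : Irreflexive _≡_ Adj

  Vertex : Set
  Vertex = Fin order

  degree : Vertex → ℕ
  degree x = length (filter (adj? x) (allFin order))

  edgeOreDegree : Vertex → Vertex → ℕ
  edgeOreDegree x y = degree x + degree y

  -- Every edge occurs once in each orientation.
  edges : List (Vertex × Vertex)
  edges = filter (uncurry adj?) (cartesianProduct (allFin order) (allFin order))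

  Proper : ∀ {k} → (Vertex → Fin k) → Set
  Proper c = ∀ x y → Adj x y → c x ≢ c y

  Colourable : ℕ → Set
  Colourable k = ∃[ c ] Proper {k} c

  proper? : ∀ {k} (c : Vertex → Fin k) → Dec (Proper c)
  proper? c = all? λ x → all? λ y → adj? x y →-dec ¬? (c x ≟ c y)

  -- Colourings with k colours are enumerated by Fin (k ^ order).
  colourable? : ∀ k → Dec (Colourable k)
  colourable? k = map′ fromCode toCode (any? (proper? ∘ decode))
    where
    decode : Fin (k ^ order) → Vertex → Fin k
    decode = finToFun

    fromCode : ∃ (Proper ∘ decode) → Colourable k
    fromCode (i , p) = decode i , p

    toCode : Colourable k → ∃ (Proper ∘ decode)
    toCode (c , p) = funToFin c , λ x y xy →
      subst₂ _≢_ (sym (finToFun-funToFin c x)) (sym (finToFun-funToFin c y)) (p x y xy)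

open Graph

-- The maximum is taken to be 0 if there are no edges.
θ : Graph → ℕ
θ G = max 0 (map (uncurry (edgeOreDegree G)) (edges G))

-- The least k such that G is k-colourable: colouring every vertex differently
-- uses order G colours, so only smaller k need to be tried.
χ : Graph → ℕ
χ G = min (order G) (filter (colourable? G) (upTo (order G)))

complete : ℕ → Graph
complete k = record
  { order  = k
  ; Adj    = _≢_
  ; adj?   = λ x y → ¬? (x ≟ y)
  ; symm   = λ x≢y → x≢y ∘ sym
  ; irrefl = λ { refl x≢x → x≢x refl }
  }

-- H is isomorphic to a (not necessarily induced) subgraph of G.
infix 4 _⊑_
_⊑_ : Graph → Graph → Set
H ⊑ G = ∃[ f ] Injective _≡_ _≡_ f × (∀ x y → Adj H x y → Adj G (f x) (f y))

{-# OPTIONS --safe #-}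

-- Write K = χ(G) - 1. In a vertex-critical subgraph every degree is at least K, so by the
-- Ore condition all degrees are K ("low") or K + 1 ("high") and the high vertices
-- are independent.
--
-- Uncolour one vertex v, colour the rest with K colours, and divide the colours
-- into two sides with r and r′ colours, r + r′ = K. If the partition of the
-- vertices into sides has minimal Lovász weight, then the component of v on its
-- side is regular (of degree r or r′), any vertex of this component can be
-- uncoloured instead of v, and a low v may change sides.
--
-- If two low vertices y, y′ of the same component have a common low neighbour on
-- the other side, then comparing degrees shows that y is a twin of all its low
-- neighbours. So the closed neighbourhood of y is K_{K+1} unless it contains two
-- high vertices, and in that case one can recolour since K ≥ 5.
--
-- Otherwise repeatedly move a low vertex of the current component to the other
-- side. The first time this walk meets an earlier component again, it produces
-- such a pair y, y′; so it never does, which is impossible in a finite graph.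

module Submission where

open import Defs
open import Data.Nat using (_≤_; _+_; ⌊_/2⌋)
open import Relation.Binary.PropositionalEquality using (_≡_)

open import Data.Bool as Bool using (Bool; true; false; not; if_then_else_; _∧_)
open import Data.Bool.Properties using (not-¬; ¬-not; not-involutive)
open import Data.Empty using (⊥; ⊥-elim)
open import Data.Fin using (Fin; zero; suc; toℕ; punchIn; punchOut; finToFun; funToFin)
open import Data.Fin.Permutation.Components using (transpose; transpose-inverse)
open import Data.Fin.Properties using (_≟_; any?; all?; pigeonhole; punchIn-punchOut; punchInᵢ≢i; finToFun-funToFin)
open import Data.List using (length; filter; tabulate; map; upTo)
open import Data.List.Extrema.Nat using (xs≤max; min≤⊤; min≤xs)
open import Data.List.Membership.Propositional.Properties
  using (∈-map⁺; ∈-filter⁺; ∈-cartesianProduct⁺; ∈-allFin; ∈-upTo⁺)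
import Data.List.Relation.Unary.All as All
open import Data.Nat as Nat using (ℕ; zero; suc; _^_; _<_; z≤n; s≤s)
open import Data.Nat.Induction using (<-rec)
open import Data.Nat.Properties hiding (_≟_)
open import Algebra.Properties.CommutativeMonoid.Sum +-0-commutativeMonoid
  using (sum; sum-cong-≗; ∑-distrib-+; sum-remove)
open import Data.Nat.Solver using (module +-*-Solver)
open import Data.Product using (_×_; _,_; ∃; ∃-syntax; proj₁; proj₂; uncurry)
open import Data.Sum using (_⊎_; inj₁; inj₂)
open import Data.Vec.Functional using (updateAt; insertAt)
open import Data.Vec.Functional.Properties using (updateAt-updates; updateAt-minimal; insertAt-punchIn)
open import Function using (_∘_; const; id; mk⇔)
open import Level using (0ℓ)
open import Relation.Binary using (Rel; Decidable)
open import Relation.Binary.Construct.Closure.ReflexiveTransitive as Star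
  using (Star; ε; _◅_; _◅◅_; reverse)
open import Relation.Binary.PropositionalEquality
  using (_≢_; _≗_; refl; sym; trans; cong; cong₂; subst; subst₂; module ≡-Reasoning)
open import Relation.Nullary using (Dec; yes; no; ¬_; does; ¬?; _×-dec_; _→-dec_; contradiction)
open import Relation.Nullary.Decidable using (map′; dec-true; dec-false; does-⇔; decidable-stable)

private
  variable
    m n : ℕ

-- Counting with Boolean predicates.

sum-mono : {f g : Fin n → ℕ} → (∀ x → f x ≤ g x) → sum f ≤ sum g
sum-mono {zero}  f≤g = z≤n
sum-mono {suc n} f≤g = +-mono-≤ (f≤g zero) (sum-mono (f≤g ∘ suc))

sum-change : (f g : Fin n → ℕ) (v : Fin n) → (∀ x → x ≢ v → f x ≡ g x) →
             sum f + g v ≡ sum g + f v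
sum-change {suc n} f g v f≡g = begin
  sum f + g v                       ≡⟨ cong (_+ g v) (sum-remove {i = v} f) ⟩
  f v + sum (f ∘ punchIn v) + g v   ≡⟨ cong (λ k → f v + k + g v) (sum-cong-≗ λ x → f≡g (punchIn v x) (punchInᵢ≢i v x)) ⟩
  f v + sum (g ∘ punchIn v) + g v   ≡⟨ solve 3 (λ a b c → a :+ b :+ c := c :+ b :+ a) refl (f v) _ (g v) ⟩
  g v + sum (g ∘ punchIn v) + f v   ≡⟨ cong (_+ f v) (sum-remove {i = v} g) ⟨
  sum g + f v                       ∎
  where
  open ≡-Reasoning
  open +-*-Solver

bit : Bool → ℕ
bit true  = 1
bit false = 0

# : (Fin n → Bool) → ℕ
# P = sum (bit ∘ P)

infixl 6 _∖_
_∖_ : (Fin n → Bool) → Fin n → Fin n → Bool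
P ∖ w = updateAt P w (const false)

∖-keeps : ∀ {P : Fin n → Bool} {w x} → P x ≡ true → x ≢ w → (P ∖ w) x ≡ true
∖-keeps {P = P} {w} {x} Px x≢w = trans (updateAt-minimal x w P x≢w) Px

∖-drops : ∀ {P : Fin n → Bool} {w x} → (P ∖ w) x ≡ true → x ≢ w
∖-drops {P = P} {w} Px refl with trans (sym Px) (updateAt-updates w P)
... | ()

∖-⊆ : ∀ {P : Fin n → Bool} {w x} → (P ∖ w) x ≡ true → P x ≡ true
∖-⊆ {P = P} {w} {x} Px = trans (sym (updateAt-minimal x w P (∖-drops {P = P} Px))) Px

#-cong : {P Q : Fin n → Bool} → P ≗ Q → # P ≡ # Q
#-cong P≗Q = sum-cong-≗ (cong bit ∘ P≗Q)

#-mono : (P Q : Fin n → Bool) → (∀ x → P x ≡ true → Q x ≡ true) → # P ≤ # Q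
#-mono P Q P⊆Q = sum-mono λ x → bit-mono (P x) (Q x) (P⊆Q x)
  where
  bit-mono : ∀ a b → (a ≡ true → b ≡ true) → bit a ≤ bit b
  bit-mono false b _ = z≤n
  bit-mono true  b a⇒b rewrite a⇒b refl = ≤-refl

#-∖ : {P : Fin n → Bool} (w : Fin n) → P w ≡ true → # P ≡ suc (# (P ∖ w))
#-∖ {P = P} w Pw = begin
  # P                         ≡⟨ +-identityʳ _ ⟨
  # P + 0                     ≡⟨ cong (λ b → # P + bit b) (updateAt-updates w P) ⟨
  # P + bit ((P ∖ w) w)       ≡⟨ sum-change (bit ∘ P) (bit ∘ (P ∖ w)) w (λ x x≢w → cong bit (sym (updateAt-minimal x w P x≢w))) ⟩
  # (P ∖ w) + bit (P w)       ≡⟨ cong (λ b → # (P ∖ w) + bit b) Pw ⟩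
  # (P ∖ w) + 1               ≡⟨ +-comm _ 1 ⟩
  suc (# (P ∖ w))             ∎
  where open ≡-Reasoning

#-∖-≤ : (P : Fin n → Bool) (w : Fin n) → # P ≤ suc (# (P ∖ w))
#-∖-≤ P w with P w in Pw
... | true  = ≤-reflexive (#-∖ w Pw)
... | false = m≤n⇒m≤1+n (#-mono P (P ∖ w) λ x Px → ∖-keeps {P = P} Px λ { refl → contradiction (trans (sym Px) Pw) λ () })

#-all : ∀ n → # {n} (const true) ≡ n
#-all zero    = refl
#-all (suc n) = cong suc (#-all n)

#-complement : {P Q : Fin n → Bool} → (∀ x → Q x ≡ not (P x)) → # P + # Q ≡ n
#-complement {n} {P} {Q} Q≗¬P = begin
  # P + # Q                            ≡⟨ ∑-distrib-+ (bit ∘ P) (bit ∘ Q) ⟨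
  sum (λ x → bit (P x) + bit (Q x))    ≡⟨ sum-cong-≗ (λ x → trans (cong (λ b → bit (P x) + bit b) (Q≗¬P x)) (bit-not (P x))) ⟩
  # {n} (const true)                   ≡⟨ #-all n ⟩
  n                                    ∎
  where
  open ≡-Reasoning
  bit-not : ∀ a → bit a + bit (not a) ≡ 1
  bit-not true  = refl
  bit-not false = refl

#-inhabited : (P : Fin n → Bool) → 1 ≤ # P → ∃[ x ] P x ≡ true
#-inhabited {suc n} P 1≤#P with P zero in eq
... | true  = zero , eq
... | false with #-inhabited (P ∘ suc) 1≤#P
... | x , Px = suc x , Px

#-surjection : {P : Fin n → Bool} {Q : Fin m → Bool} (c : Fin n → Fin m) →
               (∀ α → Q α ≡ true → ∃[ w ] P w ≡ true × c w ≡ α) → # Q ≤ # P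
#-surjection {n = zero} {m = m} {Q = Q} c cover with # Q in eq
... | zero  = z≤n
... | suc k with #-inhabited Q (subst (1 ≤_) (sym eq) (s≤s z≤n))
... | α , Qα with cover α Qα
... | () , _
#-surjection {n = suc n} {P = P} {Q} c cover with P zero in P0
... | true  = ≤-trans (#-∖-≤ Q (c zero)) (s≤s (#-surjection (c ∘ suc) tail))
  where
  tail : ∀ α → (Q ∖ c zero) α ≡ true → ∃[ w ] P (suc w) ≡ true × c (suc w) ≡ α
  tail α Qα with cover α (∖-⊆ {P = Q} Qα)
  ... | zero  , _  , c0≡α = contradiction (sym c0≡α) (∖-drops {P = Q} Qα)
  ... | suc w , Pw , cw≡α = w , Pw , cw≡α
... | false = #-surjection (c ∘ suc) tail
  where
  tail : ∀ α → Q α ≡ true → ∃[ w ] P (suc w) ≡ true × c (suc w) ≡ α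
  tail α Qα with cover α Qα
  ... | zero  , P0′ , _   = contradiction (trans (sym P0′) P0) λ ()
  ... | suc w , Pw , cw≡α = w , Pw , cw≡α

#-surjection-injective : {P : Fin n → Bool} {Q : Fin m → Bool} (c : Fin n → Fin m) →
  (∀ α → Q α ≡ true → ∃[ w ] P w ≡ true × c w ≡ α) → # P ≤ # Q →
  ∀ {w w′} → P w ≡ true → P w′ ≡ true → c w ≡ c w′ → w ≡ w′
#-surjection-injective {P = P} {Q} c cover P≤Q {w} {w′} Pw Pw′ cw≡cw′ with w ≟ w′
... | yes w≡w′ = w≡w′
... | no  w≢w′ = contradiction
  (≤-trans (≤-reflexive (sym (#-∖ w′ Pw′))) (≤-trans P≤Q (#-surjection {P = P ∖ w′} c cover′))) (<-irrefl refl)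
  where
  -- `w` covers what `w′` covered, so `P` without `w′` would still cover `Q`, against `P≤Q`.
  cover′ : ∀ α → Q α ≡ true → ∃[ u ] (P ∖ w′) u ≡ true × c u ≡ α
  cover′ α Qα with cover α Qα
  ... | u , Pu , cu≡α with u ≟ w′
  ...   | no u≢w′  = u , ∖-keeps {P = P} Pu u≢w′ , cu≡α
  ...   | yes refl = w , ∖-keeps {P = P} Pw w≢w′ , trans cw≡cw′ cu≡α

-- Decidable reachability.

-- The set found so far grows until it is closed under R.
star? : {R : Rel (Fin n) 0ℓ} → Decidable R → Decidable (Star R)
star? {n} {R} R? a b = grow n (λ x → does (a ≟ x)) (≤-trans (m≤m+n _ _) (≤-reflexive (#-complement λ x → sym (not-involutive _)))) start sound
  where
  start : does (a ≟ a) ≡ true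
  start with a ≟ a
  ... | yes _   = refl
  ... | no  a≢a = contradiction refl a≢a

  sound : ∀ x → does (a ≟ x) ≡ true → Star R a x
  sound x _ with a ≟ x
  sound x _  | yes refl = ε
  sound x () | no _

  closed⇒ : (Z : Fin n → Bool) → (∀ x y → Z x ≡ true → R x y → Z y ≡ true) →
            ∀ {x y} → Z x ≡ true → Star R x y → Z y ≡ true
  closed⇒ Z closed Zx ε        = Zx
  closed⇒ Z closed Zx (r ◅ rs) = closed⇒ Z closed (closed _ _ Zx r) rs

  grow : ∀ k (Z : Fin n → Bool) → # (not ∘ Z) ≤ k → Z a ≡ true →
         (∀ x → Z x ≡ true → Star R a x) → Dec (Star R a b)
  grow k Z ≤k Za Z⊆ with any? (λ x → any? λ y → (Z x Bool.≟ true) ×-dec R? x y ×-dec (Z y Bool.≟ false))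
  grow k Z ≤k Za Z⊆ | no stuck = map′ (Z⊆ b) (closed⇒ Z closed Za) (Z b Bool.≟ true)
    where
    closed : ∀ x y → Z x ≡ true → R x y → Z y ≡ true
    closed x y Zx r with Z y in Zy
    ... | true  = refl
    ... | false = contradiction (x , y , Zx , r , Zy) stuck
  grow zero    Z ≤k Za Z⊆ | yes (x , y , Zx , r , Zy) =
    contradiction (≤-trans (≤-reflexive (sym (#-∖ {P = not ∘ Z} y (cong not Zy)))) ≤k) λ ()
  grow (suc k) Z ≤k Za Z⊆ | yes (x , y , Zx , r , Zy) =
    grow k Z′ (≤-pred (≤-trans (≤-trans (s≤s smaller) (≤-reflexive (sym (#-∖ {P = not ∘ Z} y (cong not Zy))))) ≤k)) Z′a Z′⊆
    where
    Z′ : Fin n → Bool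
    Z′ = updateAt Z y (const true)
    smaller : # (not ∘ Z′) ≤ # ((not ∘ Z) ∖ y)
    smaller = #-mono (not ∘ Z′) ((not ∘ Z) ∖ y) λ z nZ′z → shrink z nZ′z (z ≟ y)
      where
      shrink : ∀ z → not (Z′ z) ≡ true → Dec (z ≡ y) → ((not ∘ Z) ∖ y) z ≡ true
      shrink z nZ′z (yes refl) = contradiction (trans (sym nZ′z) (cong not (updateAt-updates z Z))) λ ()
      shrink z nZ′z (no z≢y)   = ∖-keeps {P = not ∘ Z} (trans (cong not (sym (updateAt-minimal z y Z z≢y))) nZ′z) z≢y
    Z′a : Z′ a ≡ true
    Z′a with a ≟ y
    ... | yes refl = updateAt-updates a Z
    ... | no a≢y   = trans (updateAt-minimal a y Z a≢y) Za
    Z′⊆ : ∀ z → Z′ z ≡ true → Star R a z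
    Z′⊆ z Z′z with z ≟ y
    ... | yes refl = Z⊆ x Zx ◅◅ (r ◅ ε)
    ... | no z≢y   = Z⊆ z (trans (sym (updateAt-minimal z y Z z≢y)) Z′z)

-- Sides as Booleans and the arithmetic of the weight.

same : Bool → Bool → Bool
same true  b = b
same false b = not b

same⇒≡ : ∀ {a b} → same a b ≡ true → a ≡ b
same⇒≡ {true}  {true}  _ = refl
same⇒≡ {false} {false} _ = refl

≡⇒same : ∀ {a b} → a ≡ b → same a b ≡ true
≡⇒same {true}  refl = refl
≡⇒same {false} refl = refl

same-comm : ∀ a b → same a b ≡ same b a
same-comm true  true  = refl
same-comm true  false = refl
same-comm false true  = refl
same-comm false false = refl

same-not : ∀ a b → same (not a) b ≡ not (same a b)
same-not true  b = refl
same-not false b = sym (not-involutive b)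

∧⁺ : ∀ {a b} → a ≡ true → b ≡ true → a ∧ b ≡ true
∧⁺ refl refl = refl

∧⁻ : ∀ {a b} → a ∧ b ≡ true → a ≡ true × b ≡ true
∧⁻ {true} {true} _ = refl , refl

bit-split : ∀ a b → bit (a ∧ b) + bit (a ∧ not b) ≡ bit a
bit-split false b     = refl
bit-split true  true  = refl
bit-split true  false = refl

≡not⇒≢ : ∀ {a b : Bool} → a ≡ not b → a ≢ b
≡not⇒≢ refl eq = not-¬ refl (sym eq)

private
  -- With `d` and `o` the degrees of a vertex to its own and to the other side, the equation
  -- describes its change of side. If `d` exceeded `r`, the degree bound would give `o ≤ r′`, and
  -- the move would make `Φ′` smaller than `Φ`.
  potential-drops : ∀ {Φ Φ′} d o r r′ → Φ + (o + o) + (r + r) ≡ Φ′ + (d + d) + (r′ + r′) →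
                    Φ ≤ Φ′ → d + o ≤ suc (r + r′) → d ≤ r
  potential-drops {Φ} {Φ′} d o r r′ eq Φ≤Φ′ d+o≤ with d Nat.≤? r
  ... | yes d≤r = d≤r
  ... | no  d≰r = contradiction (begin-strict
      Φ + (o + o) + (r + r)       ≤⟨ +-mono-≤ (+-mono-≤ Φ≤Φ′ (+-mono-≤ o≤r′ o≤r′)) ≤-refl ⟩
      Φ′ + (r′ + r′) + (r + r)    <⟨ +-monoʳ-< (Φ′ + (r′ + r′)) (+-mono-< r<d r<d) ⟩
      Φ′ + (r′ + r′) + (d + d)    ≡⟨ solve 3 (λ a b c → a :+ b :+ c := a :+ c :+ b) refl Φ′ (r′ + r′) (d + d) ⟩
      Φ′ + (d + d) + (r′ + r′)    ≡⟨ eq ⟨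
      Φ + (o + o) + (r + r)       ∎) (<-irrefl refl)
    where
    open ≤-Reasoning
    open +-*-Solver
    r<d : r < d
    r<d = ≰⇒> d≰r
    o≤r′ : o ≤ r′
    o≤r′ = +-cancelˡ-≤ (suc r) _ _ (≤-trans (+-monoˡ-≤ o r<d) d+o≤)

  potential-balanced : ∀ {Φ Φ′} d o r r′ → Φ + (o + o) + (r + r) ≡ Φ′ + (d + d) + (r′ + r′) →
                       d ≡ r → d + o ≡ r + r′ → Φ′ ≡ Φ
  potential-balanced {Φ} {Φ′} d o r r′ eq refl d+o with +-cancelˡ-≡ d _ _ d+o
  ... | refl = sym (+-cancelʳ-≡ (o + o) _ _ (+-cancelʳ-≡ (d + d) _ _ (trans eq
    (solve 3 (λ a b c → a :+ b :+ c := a :+ c :+ b) refl Φ′ (d + d) (o + o)))))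
    where open +-*-Solver

-- Degrees and colours in critical graphs.

module Critical {n K : ℕ} (adj : Fin n → Fin n → Bool)
  (adj-sym : ∀ x y → adj x y ≡ adj y x) (adj-irr : ∀ x → adj x x ≡ false) where

  infix 4 _~_
  _~_ : Fin n → Fin n → Set
  x ~ y = adj x y ≡ true

  ~-sym : ∀ {x y} → x ~ y → y ~ x
  ~-sym {x} {y} x~y = trans (adj-sym y x) x~y

  ~⇒≢ : ∀ {x y} → x ~ y → x ≢ y
  ~⇒≢ {x} x~x refl = contradiction (trans (sym x~x) (adj-irr x)) λ ()

  deg : Fin n → ℕ
  deg x = # (adj x)

  -- In the critical graphs below every other vertex has degree K + 1.
  Low : Fin n → Set
  Low x = deg x ≡ K

  -- An uncoloured vertex is modelled by ignoring the value of a total colouring at `v`.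
  ProperOff : Fin n → (Fin n → Fin K) → Set
  ProperOff v c = ∀ x y → x ~ y → x ≢ v → y ≢ v → c x ≢ c y

  Clique : Set
  Clique = ∃ λ (f : Fin (suc K) → Fin n) → ∀ i j → i ≢ j → f i ~ f j

  Uncolourable : Set
  Uncolourable = ¬ ∃ λ (c : Fin n → Fin K) → ∀ x y → x ~ y → c x ≢ c y

  module _ (uncol : Uncolourable) where

    -- A colour missing around `v` could be given to `v`, which would colour the whole graph.
    sees-all : ∀ {v c} → ProperOff v c → ∀ α → ∃[ w ] v ~ w × c w ≡ α
    sees-all {v} {c} off α with any? (λ w → (adj v w Bool.≟ true) ×-dec (c w ≟ α))
    ... | yes seen = seen
    ... | no  free = contradiction (c′ , proper) uncol
      where
      c′ : Fin n → Fin K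
      c′ = updateAt c v (const α)
      at : c′ v ≡ α
      at = updateAt-updates v c
      away : ∀ {x} → x ≢ v → c′ x ≡ c x
      away {x} = updateAt-minimal x v c
      proper : ∀ x y → x ~ y → c′ x ≢ c′ y
      proper x y x~y eq with x ≟ v | y ≟ v
      ... | yes refl | yes refl = ~⇒≢ x~y refl
      ... | yes refl | no  y≢v  = free (y , x~y , trans (sym (away y≢v)) (trans (sym eq) at))
      ... | no  x≢v  | yes refl = free (x , ~-sym x~y , trans (sym (away x≢v)) (trans eq at))
      ... | no  x≢v  | no  y≢v  = off x y x~y x≢v y≢v (trans (sym (away x≢v)) (trans eq (away y≢v)))

    module _ (critical : ∀ v → ∃ (ProperOff v)) (ore : ∀ {x y} → x ~ y → deg x + deg y ≤ suc (K + K)) where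

      K≤deg : ∀ v → K ≤ deg v
      K≤deg v with critical v
      ... | c , off = ≤-trans (≤-reflexive (sym (#-all K))) (#-surjection c λ α _ → sees-all off α)

      deg≤1+K : 1 ≤ K → ∀ v → deg v ≤ suc K
      deg≤1+K 1≤K v with #-inhabited (adj v) (≤-trans 1≤K (K≤deg v))
      ... | w , v~w = +-cancelʳ-≤ K _ _ (≤-trans (+-monoʳ-≤ (deg v) (K≤deg w)) (ore v~w))

      high-independent : ∀ {x y} → ¬ Low x → ¬ Low y → ¬ x ~ y
      high-independent {x} {y} hx hy x~y = contradiction
        (≤-trans (+-mono-≤ (≤∧≢⇒< (K≤deg x) (hx ∘ sym)) (≤∧≢⇒< (K≤deg y) (hy ∘ sym))) (ore x~y))
        (λ le → <-irrefl refl (≤-trans (≤-reflexive (sym (+-suc (suc K) K))) le))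

      -- The `K` neighbours of `v` show all `K` colours, hence each exactly once.
      low-unique : ∀ {v c} → Low v → ProperOff v c → ∀ {w w′} → v ~ w → v ~ w′ → c w ≡ c w′ → w ≡ w′
      low-unique {v} {c} low off = #-surjection-injective c (λ α _ → sees-all off α)
        (≤-reflexive (trans low (sym (#-all K))))

      -- Twins and the clique around a low vertex.

      Twins : Rel (Fin n) 0ℓ
      Twins x y = ∀ z → z ≢ x → z ≢ y → (x ~ z → y ~ z) × (y ~ z → x ~ z)

      module Neighbourhood (5≤K : 5 ≤ K) {y} (low-y : Low y)
        (twins : ∀ {t} → Low t → y ~ t → Twins y t) where

        private
          c : Fin n → Fin K
          c = proj₁ (critical y)

          off : ProperOff y c
          off = proj₂ (critical y)

          rainbow : ∀ {w w′} → y ~ w → y ~ w′ → c w ≡ c w′ → w ≡ w′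
          rainbow = low-unique low-y off

          joined : ∀ {t z} → Low t → y ~ t → y ~ z → z ≢ t → t ~ z
          joined low y~t y~z z≢t = proj₁ (twins low y~t _ (~⇒≢ (~-sym y~z)) z≢t) y~z

          -- What prevents `h` from taking the colour of `t` when `t` is recoloured and `y` is
          -- uncoloured.
          Clash : Fin n → Fin n → Set
          Clash h t = ∃[ u ] h ~ u × u ≢ t × u ≢ y × c u ≡ c t

          clash? : ∀ h t → Dec (Clash h t)
          clash? h t = any? λ u → (adj h u Bool.≟ true) ×-dec ¬? (u ≟ t) ×-dec ¬? (u ≟ y) ×-dec (c u ≟ c t)

          -- If neither h nor h′ clashes with t, both may take the colour of t,
          -- which takes that of h′; then y no longer sees the colour of h.
          clash : ∀ {h h′ t} → y ~ h → y ~ h′ → y ~ t → ¬ Low h → ¬ Low h′ → Low t → h ≢ h′ →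
                  Clash h t ⊎ Clash h′ t
          clash {h} {h′} {t} y~h y~h′ y~t high high′ low h≢h′ with clash? h t | clash? h′ t
          ... | yes ct | _      = inj₁ ct
          ... | no _   | yes ct = inj₂ ct
          ... | no ¬ct | no ¬ct′ = contradiction (sees-all off′ (c h)) unseen
            where
            t≢h : t ≢ h
            t≢h refl = high low
            t≢h′ : t ≢ h′
            t≢h′ refl = high′ low

            c₁ c₂ c′ : Fin n → Fin K
            c₁ = updateAt c h (const (c t))
            c₂ = updateAt c₁ h′ (const (c t))
            c′ = updateAt c₂ t (const (c h′))

            data View (x : Fin n) : Set where
              is-t  : x ≡ t → c′ x ≡ c h′ → View x
              is-h  : ¬ Low x → y ~ x → ¬ Clash x t → c′ x ≡ c t → View x
              other : x ≢ t → x ≢ h → x ≢ h′ → c′ x ≡ c x → View x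

            view : ∀ x → View x
            view x with x ≟ t
            ... | yes refl = is-t refl (updateAt-updates t c₂)
            ... | no x≢t with x ≟ h′
            ...   | yes refl = is-h high′ y~h′ ¬ct′ (trans (updateAt-minimal x t c₂ x≢t) (updateAt-updates h′ c₁))
            ...   | no x≢h′ with x ≟ h
            ...     | yes refl = is-h high y~h ¬ct (trans (updateAt-minimal x t c₂ x≢t) (trans (updateAt-minimal x h′ c₁ x≢h′) (updateAt-updates h c)))
            ...     | no x≢h = other x≢t x≢h x≢h′ (trans (updateAt-minimal x t c₂ x≢t) (trans (updateAt-minimal x h′ c₁ x≢h′) (updateAt-minimal x h c x≢h)))

            -- As `t` is a twin of `y`, `u` is a neighbour of `y` too, and the neighbours of `y`
            -- have distinct colours.
            t≁other : ∀ {u} → t ~ u → u ≢ y → u ≢ t → u ≢ h′ → c h′ ≢ c u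
            t≁other t~u u≢y u≢t u≢h′ eq = u≢h′ (sym (rainbow y~h′ (proj₂ (twins low y~t _ u≢y u≢t) t~u) eq))

            h′≢t : c h′ ≢ c t
            h′≢t eq = t≢h′ (sym (rainbow y~h′ y~t eq))

            off′ : ProperOff y c′
            off′ x z x~z x≢y z≢y eq with view x | view z
            ... | is-t refl _       | is-t refl _        = ~⇒≢ x~z refl
            ... | is-t _ ex         | is-h _ _ _ ez      = h′≢t (trans (sym ex) (trans eq ez))
            ... | is-t refl ex      | other z≢t _ z≢h′ ez = t≁other x~z z≢y z≢t z≢h′ (trans (sym ex) (trans eq ez))
            ... | is-h _ _ _ ex     | is-t _ ez          = h′≢t (trans (sym ez) (trans (sym eq) ex))
            ... | is-h hx _ _ _     | is-h hz _ _ _      = high-independent hx hz x~z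
            ... | is-h _ _ ¬cx ex   | other z≢t _ _ ez   = ¬cx (z , x~z , z≢t , z≢y , trans (sym ez) (trans (sym eq) ex))
            ... | other x≢t _ x≢h′ ex | is-t refl ez     = t≁other (~-sym x~z) x≢y x≢t x≢h′ (trans (sym ez) (trans (sym eq) ex))
            ... | other x≢t _ _ ex  | is-h _ _ ¬cz ez    = ¬cz (x , ~-sym x~z , x≢t , x≢y , trans (sym ex) (trans eq ez))
            ... | other _ _ _ ex    | other _ _ _ ez     = off x z x~z x≢y z≢y (trans (sym ex) (trans eq ez))

            unseen : ¬ (∃[ w ] y ~ w × c′ w ≡ c h)
            unseen (w , y~w , eq) with view w
            ... | is-t _ ew        = h≢h′ (rainbow y~h y~h′ (trans (sym eq) ew))
            ... | is-h _ _ _ ew    = t≢h (rainbow y~t y~h (trans (sym ew) eq))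
            ... | other _ w≢h _ ew = w≢h (rainbow y~w y~h (trans (sym ew) eq))

          -- Uncolour h instead of y: having degree K + 1, h sees only one colour twice.
          one-clash : ∀ {h t t′} → y ~ h → y ~ t → y ~ t′ → ¬ Low h → Low t → Low t′ → t ≢ t′ →
                      Clash h t → Clash h t′ → ⊥
          one-clash {h} {t} {t′} y~h y~t y~t′ high low low′ t≢t′ (u , h~u , u≢t , u≢y , cu) (u′ , h~u′ , u′≢t′ , u′≢y , cu′) =
            <-irrefl refl (begin-strict
              suc K               ≤⟨ s≤s (≤-trans (≤-reflexive (sym (#-all K))) (#-surjection c′ λ α _ → cover α)) ⟩
              suc (# (adj h ∖ u ∖ u′)) <⟨ ≤-reflexive (sym (trans (#-∖ u h~u) (cong suc (#-∖ u′ (∖-keeps {P = adj h} h~u′ u′≢u))))) ⟩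
              deg h               ≤⟨ deg≤1+K (≤-trans (s≤s z≤n) 5≤K) h ⟩
              suc K               ∎)
            where
            open ≤-Reasoning
            ct≢ct′ : c t ≢ c t′
            ct≢ct′ eq = t≢t′ (rainbow y~t y~t′ eq)
            u′≢u : u′ ≢ u
            u′≢u refl = ct≢ct′ (trans (sym cu) cu′)
            t≢u′ : t ≢ u′
            t≢u′ refl = ct≢ct′ cu′
            t′≢u : t′ ≢ u
            t′≢u refl = ct≢ct′ (sym cu)
            t≢h : t ≢ h
            t≢h refl = high low
            t′≢h : t′ ≢ h
            t′≢h refl = high low′

            c′ : Fin n → Fin K
            c′ = updateAt c y (const (c h))
            at : c′ y ≡ c h
            at = updateAt-updates y c
            away : ∀ {x} → x ≢ y → c′ x ≡ c x
            away {x} = updateAt-minimal x y c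
            off′ : ProperOff h c′
            off′ x z x~z x≢h z≢h eq with x ≟ y | z ≟ y
            ... | yes refl | yes refl = ~⇒≢ x~z refl
            ... | yes refl | no  z≢y  = z≢h (sym (rainbow y~h x~z (trans (sym at) (trans eq (away z≢y)))))
            ... | no  x≢y  | yes refl = x≢h (sym (rainbow y~h (~-sym x~z) (trans (sym at) (trans (sym eq) (away x≢y)))))
            ... | no  x≢y  | no  z≢y  = off x z x~z x≢y z≢y (trans (sym (away x≢y)) (trans eq (away z≢y)))

            remains : ∀ {w} → h ~ w → w ≢ u → w ≢ u′ → (adj h ∖ u ∖ u′) w ≡ true
            remains h~w w≢u w≢u′ = ∖-keeps {P = adj h ∖ u} (∖-keeps {P = adj h} h~w w≢u) w≢u′

            recolour : ∀ {t u} → y ~ t → u ≢ y → c u ≡ c t → c′ t ≡ c′ u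
            recolour y~t u≢y cu = trans (away (~⇒≢ (~-sym y~t))) (trans (sym cu) (sym (away u≢y)))

            -- Without `u` and `u′`, `h` still sees every colour: `t` and `t′`, being twins of `y`,
            -- are adjacent to `h` and repeat these two colours. But fewer than `K` neighbours
            -- remain.
            cover : ∀ α → ∃[ w ] (adj h ∖ u ∖ u′) w ≡ true × c′ w ≡ α
            cover α with sees-all off′ α
            ... | w , h~w , refl with w ≟ u | w ≟ u′
            ...   | yes refl | _ = t , remains (~-sym (joined low y~t y~h (t≢h ∘ sym))) (u≢t ∘ sym) t≢u′ , recolour y~t u≢y cu
            ...   | no _ | yes refl = t′ , remains (~-sym (joined low′ y~t′ y~h (t′≢h ∘ sym))) t′≢u (u′≢t′ ∘ sym) , recolour y~t′ u′≢y cu′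
            ...   | no w≢u | no w≢u′ = w , remains h~w w≢u w≢u′ , refl

          -- Each of the three low vertices clashes with `h` or `h′`, so two of them clash with the
          -- same one.
          two-highs-three-lows : ∀ {h h′ t t′ t″} → y ~ h → y ~ h′ → y ~ t → y ~ t′ → y ~ t″ →
            ¬ Low h → ¬ Low h′ → Low t → Low t′ → Low t″ → h ≢ h′ → t ≢ t′ → t ≢ t″ → t′ ≢ t″ → ⊥
          two-highs-three-lows {h} {h′} {t} {t′} {t″} yh yh′ yt yt′ yt″ hh hh′ lt lt′ lt″ h≢h′ t≢t′ t≢t″ t′≢t″
            with clash yh yh′ yt hh hh′ lt h≢h′ | clash yh yh′ yt′ hh hh′ lt′ h≢h′ | clash yh yh′ yt″ hh hh′ lt″ h≢h′
          ... | inj₁ a | inj₁ b | _      = one-clash yh yt yt′ hh lt lt′ t≢t′ a b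
          ... | inj₂ a | inj₂ b | _      = one-clash yh′ yt yt′ hh′ lt lt′ t≢t′ a b
          ... | inj₁ a | inj₂ b | inj₁ d = one-clash yh yt yt″ hh lt lt″ t≢t″ a d
          ... | inj₁ a | inj₂ b | inj₂ d = one-clash yh′ yt′ yt″ hh′ lt′ lt″ t′≢t″ b d
          ... | inj₂ a | inj₁ b | inj₁ d = one-clash yh yt′ yt″ hh lt′ lt″ t′≢t″ b d
          ... | inj₂ a | inj₁ b | inj₂ d = one-clash yh′ yt yt″ hh′ lt lt″ t≢t″ a d

          -- By `clash`, each low vertex fails to clash with at most one high vertex, so one of the
          -- three high vertices clashes with both low ones.
          three-highs-two-lows : ∀ {h h′ h″ t t′} → y ~ h → y ~ h′ → y ~ h″ → y ~ t → y ~ t′ →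
            ¬ Low h → ¬ Low h′ → ¬ Low h″ → Low t → Low t′ → h ≢ h′ → h ≢ h″ → h′ ≢ h″ → t ≢ t′ → ⊥
          three-highs-two-lows {h} {h′} {h″} {t} {t′} yh yh′ yh″ yt yt′ hh hh′ hh″ lt lt′ h≢h′ h≢h″ h′≢h″ t≢t′
            with clash yh yh′ yt hh hh′ lt h≢h′ | clash yh yh′ yt′ hh hh′ lt′ h≢h′
          ... | inj₁ a | inj₁ b = one-clash yh yt yt′ hh lt lt′ t≢t′ a b
          ... | inj₂ a | inj₂ b = one-clash yh′ yt yt′ hh′ lt lt′ t≢t′ a b
          ... | inj₁ a | inj₂ b with clash yh′ yh″ yt hh′ hh″ lt h′≢h″ | clash yh yh″ yt′ hh hh″ lt′ h≢h″
          ...   | inj₁ d | _      = one-clash yh′ yt yt′ hh′ lt lt′ t≢t′ d b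
          ...   | inj₂ d | inj₁ e = one-clash yh yt yt′ hh lt lt′ t≢t′ a e
          ...   | inj₂ d | inj₂ e = one-clash yh″ yt yt′ hh″ lt lt′ t≢t′ d e
          three-highs-two-lows {h} {h′} {h″} {t} {t′} yh yh′ yh″ yt yt′ hh hh′ hh″ lt lt′ h≢h′ h≢h″ h′≢h″ t≢t′
              | inj₂ a | inj₁ b with clash yh yh″ yt hh hh″ lt h≢h″ | clash yh′ yh″ yt′ hh′ hh″ lt′ h′≢h″
          ...   | inj₁ d | _      = one-clash yh yt yt′ hh lt lt′ t≢t′ d b
          ...   | inj₂ d | inj₁ e = one-clash yh′ yt yt′ hh′ lt lt′ t≢t′ a e
          ...   | inj₂ d | inj₂ e = one-clash yh″ yt yt′ hh″ lt lt′ t≢t′ d e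

        -- Since `5 ≤ K`, `y` has a fifth neighbour `q`; whether it is low or high decides which of
        -- the two counts above applies.
        one-high : ∀ {t t′ h h′} → y ~ t → y ~ t′ → Low t → Low t′ → t ≢ t′ →
                   y ~ h → y ~ h′ → ¬ Low h → ¬ Low h′ → h ≢ h′ → ⊥
        one-high {t} {t′} {h} {h′} y~t y~t′ low low′ t≢t′ y~h y~h′ high high′ h≢h′
          with #-inhabited (adj y ∖ h ∖ h′ ∖ t ∖ t′) (≤-pred (≤-pred (≤-pred (≤-pred (begin
            5                                    ≤⟨ 5≤K ⟩
            K                                    ≡⟨ low-y ⟨
            deg y                                ≤⟨ #-∖-≤ (adj y) h ⟩
            1 + # (adj y ∖ h)                    ≤⟨ s≤s (#-∖-≤ (adj y ∖ h) h′) ⟩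
            2 + # (adj y ∖ h ∖ h′)               ≤⟨ s≤s (s≤s (#-∖-≤ (adj y ∖ h ∖ h′) t)) ⟩
            3 + # (adj y ∖ h ∖ h′ ∖ t)           ≤⟨ s≤s (s≤s (s≤s (#-∖-≤ (adj y ∖ h ∖ h′ ∖ t) t′))) ⟩
            4 + # (adj y ∖ h ∖ h′ ∖ t ∖ t′)      ∎)))))
          where open ≤-Reasoning
        ... | q , q∈₄ with ∖-⊆ {P = adj y ∖ h ∖ h′ ∖ t} q∈₄
        ... | q∈₃ with ∖-⊆ {P = adj y ∖ h ∖ h′} q∈₃
        ... | q∈₂ with ∖-⊆ {P = adj y ∖ h} q∈₂
        ... | q∈₁ with deg q Nat.≟ K
        ...   | yes lq = two-highs-three-lows y~h y~h′ y~t y~t′ (∖-⊆ {P = adj y} q∈₁) high high′ low low′ lq h≢h′ t≢t′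
                         (∖-drops {P = adj y ∖ h ∖ h′} q∈₃ ∘ sym) (∖-drops {P = adj y ∖ h ∖ h′ ∖ t} q∈₄ ∘ sym)
        ...   | no hq = three-highs-two-lows y~h y~h′ (∖-⊆ {P = adj y} q∈₁) y~t y~t′ high high′ hq low low′ h≢h′
                         (∖-drops {P = adj y} q∈₁ ∘ sym) (∖-drops {P = adj y ∖ h} q∈₂ ∘ sym) t≢t′

        clique : ∀ {t t′} → y ~ t → y ~ t′ → Low t → Low t′ → t ≢ t′ → Clique
        clique {t} {t′} y~t y~t′ low low′ t≢t′ = f , pairwise
          where
          nbr : ∀ α → ∃[ w ] y ~ w × c w ≡ α
          nbr = sees-all off
          f : Fin (suc K) → Fin n
          f zero    = y
          f (suc α) = proj₁ (nbr α)
          y~f : ∀ α → y ~ f (suc α)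
          y~f α = proj₁ (proj₂ (nbr α))
          f-injective : ∀ {α β} → f (suc α) ≡ f (suc β) → α ≡ β
          f-injective {α} {β} eq = trans (sym (proj₂ (proj₂ (nbr α)))) (trans (cong c eq) (proj₂ (proj₂ (nbr β))))
          pairwise : ∀ i j → i ≢ j → f i ~ f j
          pairwise zero    zero    0≢0 = contradiction refl 0≢0
          pairwise zero    (suc β) _   = y~f β
          pairwise (suc α) zero    _   = ~-sym (y~f α)
          pairwise (suc α) (suc β) α≢β with deg (f (suc α)) Nat.≟ K | deg (f (suc β)) Nat.≟ K
          ... | yes lα | _      = joined lα (y~f α) (y~f β) λ eq → α≢β (cong suc (f-injective (sym eq)))
          ... | no _   | yes lβ = ~-sym (joined lβ (y~f β) (y~f α) λ eq → α≢β (cong suc (f-injective eq)))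
          ... | no hα  | no hβ  = ⊥-elim (one-high y~t y~t′ low low′ t≢t′ (y~f α) (y~f β) hα hβ λ eq → α≢β (cong suc (f-injective eq)))

      -- Partitions into two sides and their Lovász weight.

      module Sides (side : Fin K → Bool)
        (two : ∀ s → ∃[ α ] ∃[ β ] α ≢ β × side α ≡ s × side β ≡ s) where

        1≤K : 1 ≤ K
        1≤K with two true
        ... | zero , _ = s≤s z≤n
        ... | suc _ , _ = s≤s z≤n

        r : Bool → ℕ
        r s = # (λ α → same s (side α))

        r+r : ∀ s → r s + r (not s) ≡ K
        r+r s = #-complement λ α → same-not s (side α)

        2≤r : ∀ s → 2 ≤ r s
        2≤r s with two s
        ... | α , β , α≢β , sα , sβ = subst (2 ≤_)
          (sym (trans (#-∖ α (≡⇒same (sym sα))) (cong suc (#-∖ β (∖-keeps {P = λ α → same s (side α)} (≡⇒same (sym sβ)) (α≢β ∘ sym))))))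
          (s≤s (s≤s z≤n))

        nbrs : (Fin n → Bool) → Fin n → Bool → Fin n → Bool
        nbrs p v s y = adj v y ∧ same s (p y)

        sideDeg : (Fin n → Bool) → Fin n → Bool → ℕ
        sideDeg p v s = # (nbrs p v s)

        sideDeg-split : ∀ p v s → sideDeg p v s + sideDeg p v (not s) ≡ deg v
        sideDeg-split p v s = trans (sym (∑-distrib-+ (bit ∘ nbrs p v s) (bit ∘ nbrs p v (not s))))
          (sum-cong-≗ λ y → trans (cong (λ b → bit (nbrs p v s y) + bit (adj v y ∧ b)) (same-not s (p y)))
                                  (bit-split (adj v y) (same s (p y))))

        flip : Fin n → (Fin n → Bool) → Fin n → Bool
        flip v p = updateAt p v not

        flip-at : ∀ v p → flip v p v ≡ not (p v)
        flip-at v p = updateAt-updates v p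

        flip-off : ∀ {v x} p → x ≢ v → flip v p x ≡ p x
        flip-off {v} {x} p = updateAt-minimal x v p

        flip-flip : ∀ v p → flip v (flip v p) ≗ p
        flip-flip v p x with x ≟ v
        ... | yes refl = trans (flip-at v (flip v p)) (trans (cong not (flip-at v p)) (not-involutive (p v)))
        ... | no x≢v   = trans (flip-off (flip v p) x≢v) (flip-off p x≢v)

        inDeg : (Fin n → Bool) → Fin n → ℕ
        inDeg p x = sideDeg p x (p x)

        inDeg-flip : ∀ v p → inDeg (flip v p) v ≡ sideDeg p v (not (p v))
        inDeg-flip v p = #-cong pointwise
          where
          pointwise : nbrs (flip v p) v (flip v p v) ≗ nbrs p v (not (p v))
          pointwise y with y ≟ v
          ... | yes refl rewrite adj-irr v = refl
          ... | no y≢v = cong₂ (λ s t → adj v y ∧ same s t) (flip-at v p) (flip-off p y≢v)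

        -- Adding `r (not s)`, which is `K` minus `r s`, replaces the subtraction of `r s` and stays
        -- within ℕ. It is doubled because the sum of `inDeg` counts every edge twice.
        weight : (Fin n → Bool) → Fin n → ℕ
        weight p x = r (not (p x)) + r (not (p x))

        -- Twice Lovász's weight ∑ₛ (e(Vₛ) - rₛ|Vₛ|), up to an additive constant.
        Φ : (Fin n → Bool) → ℕ
        Φ p = sum (inDeg p) + sum (weight p)

        Φ-cong : ∀ {p q} → p ≗ q → Φ p ≡ Φ q
        Φ-cong p≗q = cong₂ _+_
          (sum-cong-≗ λ x → #-cong λ y → cong₂ (λ s t → adj x y ∧ same s t) (p≗q x) (p≗q y))
          (sum-cong-≗ λ x → cong (λ s → r (not s) + r (not s)) (p≗q x))

        -- In the matrix of edges within sides, a flip of `v` changes only the row and the column of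
        -- `v`. By symmetry both sum to the inner degree of `v`, and the diagonal entry is zero.
        inDeg-change : ∀ v p → sum (inDeg p) + (inDeg (flip v p) v + inDeg (flip v p) v) ≡
                               sum (inDeg (flip v p)) + (inDeg p v + inDeg p v)
        inDeg-change v p = begin
          sum (inDeg p) + (d′ + d′)                          ≡⟨ +-assoc (sum (inDeg p)) d′ d′ ⟨
          sum (inDeg p) + d′ + d′                            ≡⟨ cong (λ k → sum (inDeg p) + k + d′) (column p′) ⟨
          sum (inDeg p) + sum (λ x → bit (e p′ x v)) + d′    ≡⟨ cong (_+ d′) (∑-distrib-+ (inDeg p) _) ⟨
          sum (λ x → inDeg p x + bit (e p′ x v)) + d′        ≡⟨ cong (sum (λ x → inDeg p x + bit (e p′ x v)) +_) (diagonal p p′) ⟨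
          sum (λ x → inDeg p x + bit (e p′ x v)) + (inDeg p′ v + bit (e p v v))
            ≡⟨ sum-change (λ x → inDeg p x + bit (e p′ x v)) (λ x → inDeg p′ x + bit (e p x v)) v row ⟩
          sum (λ x → inDeg p′ x + bit (e p x v)) + (inDeg p v + bit (e p′ v v))
            ≡⟨ cong (sum (λ x → inDeg p′ x + bit (e p x v)) +_) (diagonal p′ p) ⟩
          sum (λ x → inDeg p′ x + bit (e p x v)) + d         ≡⟨ cong (_+ d) (∑-distrib-+ (inDeg p′) _) ⟩
          sum (inDeg p′) + sum (λ x → bit (e p x v)) + d     ≡⟨ cong (λ k → sum (inDeg p′) + k + d) (column p) ⟩
          sum (inDeg p′) + d + d                             ≡⟨ +-assoc (sum (inDeg p′)) d d ⟩
          sum (inDeg p′) + (d + d)                           ∎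
          where
          open ≡-Reasoning
          p′ = flip v p
          d  = inDeg p v
          d′ = inDeg p′ v
          e : (Fin n → Bool) → Fin n → Fin n → Bool
          e q x y = adj x y ∧ same (q x) (q y)
          column : ∀ q → sum (λ x → bit (e q x v)) ≡ inDeg q v
          column q = sum-cong-≗ λ x → cong bit (cong₂ _∧_ (adj-sym x v) (same-comm (q x) (q v)))
          diagonal : ∀ q q′ → inDeg q′ v + bit (e q v v) ≡ inDeg q′ v
          diagonal q q′ rewrite adj-irr v = +-identityʳ _
          row : ∀ x → x ≢ v → inDeg p x + bit (e p′ x v) ≡ inDeg p′ x + bit (e p x v)
          row x x≢v = sum-change (bit ∘ e p x) (bit ∘ e p′ x) v λ y y≢v →
            cong bit (cong₂ (λ s t → adj x y ∧ same s t) (sym (flip-off p x≢v)) (sym (flip-off p y≢v)))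

        Φ-flip : ∀ v p → Φ p + (sideDeg p v (not (p v)) + sideDeg p v (not (p v))) + (r (p v) + r (p v)) ≡
                         Φ (flip v p) + (inDeg p v + inDeg p v) + (r (not (p v)) + r (not (p v)))
        Φ-flip v p = begin
          a + b + (o + o) + (s + s)       ≡⟨ solve 4 (λ a b o s → a :+ b :+ (o :+ o) :+ (s :+ s) := a :+ (o :+ o) :+ (b :+ (s :+ s))) refl a b o s ⟩
          a + (o + o) + (b + (s + s))     ≡⟨ cong₂ _+_ (trans (cong (λ k → a + (k + k)) (sym (inDeg-flip v p))) (inDeg-change v p)) weights ⟩
          a′ + (d + d) + (b′ + (s′ + s′)) ≡⟨ solve 4 (λ a b o s → a :+ (o :+ o) :+ (b :+ (s :+ s)) := a :+ b :+ (o :+ o) :+ (s :+ s)) refl a′ b′ d s′ ⟩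
          a′ + b′ + (d + d) + (s′ + s′)   ∎
          where
          open ≡-Reasoning
          open +-*-Solver
          p′ = flip v p
          a = sum (inDeg p)
          b = sum (weight p)
          a′ = sum (inDeg p′)
          b′ = sum (weight p′)
          o = sideDeg p v (not (p v))
          d = inDeg p v
          s = r (p v)
          s′ = r (not (p v))
          weights : b + (s + s) ≡ b′ + (s′ + s′)
          weights = trans (cong (λ t → b + (r t + r t)) (sym (trans (cong not (flip-at v p)) (not-involutive (p v)))))
            (sum-change (weight p) (weight p′) v λ x x≢v → cong (λ t → r (not t) + r (not t)) (sym (flip-off p x≢v)))

        -- v is uncoloured: c v is junk, except that its side says where v is counted.
        Pre : Fin n → (Fin n → Bool) → Set
        Pre v p = ∃[ c ] ProperOff v c × (∀ x → side (c x) ≡ p x)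

        -- Configurations of minimal weight.

        module Minimal (m : ℕ) (minimal : ∀ {v p} → Pre v p → m ≤ Φ p) where

          record Cfg (v : Fin n) (p : Fin n → Bool) : Set where
            constructor _,_
            field
              pre     : Pre v p
              optimal : Φ p ≡ m

          open Cfg

          cfg-cong : ∀ {v p q} → p ≗ q → Cfg v p → Cfg v q
          cfg-cong p≗q ((c , off , sides) , Φ≡m) =
            (c , off , λ x → trans (sides x) (p≗q x)) , trans (sym (Φ-cong p≗q)) Φ≡m

          -- Only the junk colour of `v` changes, to any colour of the other side.
          pre-flip : ∀ {v p} → Pre v p → Pre v (flip v p)
          pre-flip {v} {p} (c , off , sides) with two (not (p v))
          ... | α , _ , _ , sα , _ = updateAt c v (const α) , off′ , sides′
            where
            away : ∀ {x} → x ≢ v → updateAt c v (const α) x ≡ c x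
            away {x} = updateAt-minimal x v c
            off′ : ProperOff v (updateAt c v (const α))
            off′ x y x~y x≢v y≢v eq = off x y x~y x≢v y≢v (trans (sym (away x≢v)) (trans eq (away y≢v)))
            sides′ : ∀ x → side (updateAt c v (const α) x) ≡ flip v p x
            sides′ x with x ≟ v
            ... | yes refl = trans (cong side (updateAt-updates v c)) (trans sα (sym (flip-at v p)))
            ... | no x≢v = trans (cong side (away x≢v)) (trans (sides x) (sym (flip-off p x≢v)))

          side-cover : ∀ {v p} ((c , off , sides) : Pre v p) s α → same s (side α) ≡ true →
                       ∃[ w ] nbrs p v s w ≡ true × c w ≡ α
          side-cover (c , off , sides) s α sα with sees-all off α
          ... | w , v~w , refl = w , ∧⁺ v~w (trans (cong (same s) (sym (sides w))) sα) , refl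

          -- At most, because moving `v` across does not lower the weight; at least, because `v`
          -- sees every colour of its side.
          regular : ∀ {v p} → Cfg v p → inDeg p v ≡ r (p v)
          regular {v} {p} (pre , Φ≡m) = ≤-antisym
            (potential-drops (inDeg p v) (sideDeg p v (not (p v))) (r (p v)) (r (not (p v))) (Φ-flip v p)
              (≤-trans (≤-reflexive Φ≡m) (minimal (pre-flip pre)))
              (≤-trans (≤-reflexive (sideDeg-split p v (p v))) (≤-trans (deg≤1+K 1≤K v) (s≤s (≤-reflexive (sym (r+r (p v))))))))
            (#-surjection (proj₁ pre) (side-cover pre (p v)))

          side-unique : ∀ {v p} (cfg : Cfg v p) → let c = proj₁ (pre cfg) in
                        ∀ {w w′} → v ~ w → p w ≡ p v → v ~ w′ → c w ≡ c w′ → w ≡ w′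
          side-unique {v} {p} cfg@(pre@(c , off , sides) , Φ≡m) {w} {w′} v~w pw v~w′ eq =
            #-surjection-injective c (side-cover pre (p v)) (≤-reflexive (regular cfg))
              (∧⁺ v~w (≡⇒same (sym pw)))
              (∧⁺ v~w′ (≡⇒same (trans (sym pw) (trans (sym (sides w)) (trans (cong side eq) (sides w′))))))
              eq

          -- `v` takes the colour of `w`: by `side-unique` no other neighbour of `v` has it.
          shift : ∀ {v w p} → Cfg v p → v ~ w → p w ≡ p v → Cfg w p
          shift {v} {w} {p} cfg@((c , off , sides) , Φ≡m) v~w pw = (c′ , off′ , sides′) , Φ≡m
            where
            c′ : Fin n → Fin K
            c′ = updateAt c v (const (c w))
            at : c′ v ≡ c w
            at = updateAt-updates v c
            away : ∀ {x} → x ≢ v → c′ x ≡ c x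
            away {x} = updateAt-minimal x v c
            off′ : ProperOff w c′
            off′ x y x~y x≢w y≢w eq with x ≟ v | y ≟ v
            ... | yes refl | yes refl = ~⇒≢ x~y refl
            ... | yes refl | no  y≢v  = y≢w (sym (side-unique cfg v~w pw x~y (trans (sym at) (trans eq (away y≢v)))))
            ... | no  x≢v  | yes refl = x≢w (sym (side-unique cfg v~w pw (~-sym x~y) (trans (sym at) (trans (sym eq) (away x≢v)))))
            ... | no  x≢v  | no  y≢v  = off x y x~y x≢v y≢v (trans (sym (away x≢v)) (trans eq (away y≢v)))
            sides′ : ∀ x → side (c′ x) ≡ p x
            sides′ x with x ≟ v
            ... | yes refl = trans (cong side at) (trans (sides w) pw)
            ... | no  x≢v  = trans (cong side (away x≢v)) (sides x)

          -- By `regular`, a low `v` has exactly `r (not (p v))` neighbours across, so the move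
          -- leaves the weight unchanged.
          low-flip : ∀ {v p} → Low v → Cfg v p → Cfg v (flip v p)
          low-flip {v} {p} low cfg@(pre , Φ≡m) = pre-flip pre , trans
            (potential-balanced (inDeg p v) (sideDeg p v (not (p v))) (r (p v)) (r (not (p v))) (Φ-flip v p) (regular cfg)
              (trans (sideDeg-split p v (p v)) (trans low (sym (r+r (p v)))))) Φ≡m

          -- Components within a side.

          Same : (Fin n → Bool) → Rel (Fin n) 0ℓ
          Same p x y = x ~ y × p x ≡ p y

          Off : (Fin n → Bool) → Fin n → Rel (Fin n) 0ℓ
          Off p v x y = Same p x y × x ≢ v × y ≢ v

          same? : ∀ p → Decidable (Same p)
          same? p x y = (adj x y Bool.≟ true) ×-dec (p x Bool.≟ p y)

          off? : ∀ p v → Decidable (Off p v)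
          off? p v x y = same? p x y ×-dec ¬? (x ≟ v) ×-dec ¬? (y ≟ v)

          Path : (Fin n → Bool) → Rel (Fin n) 0ℓ
          Path p = Star (Same p)

          OffPath : (Fin n → Bool) → Fin n → Rel (Fin n) 0ℓ
          OffPath p v = Star (Off p v)

          same-sym : ∀ {p x y} → Same p x y → Same p y x
          same-sym (x~y , eq) = ~-sym x~y , sym eq

          path-sym : ∀ {p x y} → Path p x y → Path p y x
          path-sym = reverse same-sym

          offPath-sym : ∀ {p v x y} → OffPath p v x y → OffPath p v y x
          offPath-sym = reverse λ (e , x≢v , y≢v) → same-sym e , y≢v , x≢v

          path-side : ∀ {p x y} → Path p x y → p x ≡ p y
          path-side ε              = refl
          path-side ((_ , eq) ◅ π) = trans eq (path-side π)

          path-cong : ∀ {p q x y} → p ≗ q → Path p x y → Path q x y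
          path-cong {q = q} p≗q = Star.map λ {x} {y} (x~y , eq) → x~y , trans (sym (p≗q x)) (trans eq (p≗q y))

          shift* : ∀ {v x p} → Cfg v p → Path p v x → Cfg x p
          shift* cfg ε                = cfg
          shift* cfg ((v~w , eq) ◅ π) = shift* (shift cfg v~w (sym eq)) π

          -- Cut the path at its last visit to `v`.
          last-exit : ∀ {p v z} → Path p v z → z ≢ v → ∃[ a ] v ~ a × p a ≡ p v × OffPath p v a z
          last-exit {p} {v} {z} π z≢v with go π
            where
            go : ∀ {x} → Path p x z → (x ≢ v × OffPath p v x z) ⊎ (∃[ a ] v ~ a × p a ≡ p v × OffPath p v a z)
            go ε = inj₁ (z≢v , ε)
            go (_◅_ {x} (x~y , eq) π) with go π
            ... | inj₂ found = inj₂ found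
            ... | inj₁ (y≢v , ρ) with x ≟ v
            ...   | yes refl = inj₂ (_ , x~y , sym eq , ρ)
            ...   | no x≢v   = inj₁ (x≢v , ((x~y , eq) , x≢v , y≢v) ◅ ρ)
          ... | inj₁ (v≢v , _) = contradiction refl v≢v
          ... | inj₂ found     = found

          -- Otherwise swapping the colours of a and b on the component of a
          -- would free the colour of a at v.
          linked : ∀ {v p a b} → Cfg v p → v ~ a → p a ≡ p v → v ~ b → p b ≡ p v → OffPath p v a b
          linked {v} {p} {a} {b} cfg@((c , off , sides) , Φ≡m) v~a pa v~b pb with star? (off? p v) a b
          ... | yes π = π
          ... | no ¬π = contradiction (sees-all off′ (c a)) unseen
            where
            τ : Fin K → Fin K
            τ = transpose (c a) (c b)

            Z? : ∀ x → Dec (OffPath p v a x)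
            Z? = star? (off? p v) a

            c′ : Fin n → Fin K
            c′ x = if does (Z? x) then τ (c x) else c x

            inside : ∀ {x} → OffPath p v a x → c′ x ≡ τ (c x)
            inside {x} π rewrite dec-true (Z? x) π = refl

            outside : ∀ {x} → ¬ OffPath p v a x → c′ x ≡ c x
            outside {x} ¬π rewrite dec-false (Z? x) ¬π = refl

            τ-injective : ∀ {i j} → τ i ≡ τ j → i ≡ j
            τ-injective {i} {j} eq = trans (sym (transpose-inverse (c b) (c a)))
              (trans (cong (transpose (c b) (c a)) eq) (transpose-inverse (c b) (c a)))

            τ-b : τ (c b) ≡ c a
            τ-b with c b ≟ c a
            ... | yes b≡a = b≡a
            ... | no _ rewrite dec-true (c b ≟ c b) refl = refl

            τ-side : ∀ i → side (τ i) ≡ side i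
            τ-side i with i ≟ c a
            ... | yes refl = trans (sides b) (trans pb (sym (trans (sides a) pa)))
            ... | no _ with i ≟ c b
            ...   | yes refl = trans (sides a) (trans pa (sym (trans (sides b) pb)))
            ...   | no _     = refl

            boundary : ∀ {x y} → OffPath p v a x → ¬ OffPath p v a y → x ~ y → x ≢ v → y ≢ v → τ (c x) ≢ c y
            boundary {x} {y} πx ¬πy x~y x≢v y≢v eq = ¬πy (πx ◅◅ ((x~y , trans (sym (sides x))
              (trans (sym (τ-side (c x))) (trans (cong side eq) (sides y)))) , x≢v , y≢v) ◅ ε)

            off′ : ProperOff v c′
            off′ x y x~y x≢v y≢v eq with Z? x | Z? y
            ... | yes πx | yes πy = off x y x~y x≢v y≢v (τ-injective eq)
            ... | yes πx | no ¬πy = boundary πx ¬πy x~y x≢v y≢v eq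
            ... | no ¬πx | yes πy = boundary πy ¬πx (~-sym x~y) y≢v x≢v (sym eq)
            ... | no _   | no _   = off x y x~y x≢v y≢v eq

            unseen : ¬ (∃[ w ] v ~ w × c′ w ≡ c a)
            unseen (w , v~w , eq) with Z? w
            ... | yes πw = ¬π (subst (OffPath p v a)
                    (sym (side-unique cfg v~b pb v~w (τ-injective (trans τ-b (sym eq))))) πw)
            ... | no ¬πw = ¬πw (subst (OffPath p v a) (side-unique cfg v~a pa v~w (sym eq)) ε)

          -- Otherwise high and low vertices 2-colour the component of v.
          low-edge : ∀ {v p} → Cfg v p →
                     ∃[ x ] ∃[ y ] Path p v x × Path p v y × x ~ y × Low x × Low y
          low-edge {v} {p} cfg@((c , off , sides) , Φ≡m)
            with any? (λ x → any? λ y → star? (same? p) v x ×-dec star? (same? p) v y ×-dec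
                   (adj x y Bool.≟ true) ×-dec (deg x Nat.≟ K) ×-dec (deg y Nat.≟ K))
          ... | yes found = found
          ... | no  none with two (p v)
          ...   | α , β , α≢β , sα , sβ = contradiction (c′ , proper) uncol
            where
            Z? : ∀ x → Dec (Path p v x)
            Z? = star? (same? p) v

            low? : ∀ x → Dec (Low x)
            low? x = deg x Nat.≟ K

            γ : Fin n → Fin K
            γ x = if does (low? x) then α else β

            γ-low : ∀ {x} → Low x → γ x ≡ α
            γ-low {x} low = cong (λ b → if b then α else β) (dec-true (low? x) low)

            γ-high : ∀ {x} → ¬ Low x → γ x ≡ β
            γ-high {x} high = cong (λ b → if b then α else β) (dec-false (low? x) high)

            γ-side : ∀ x → side (γ x) ≡ p v
            γ-side x with does (low? x)
            ... | true  = sα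
            ... | false = sβ

            c′ : Fin n → Fin K
            c′ x = if does (Z? x) then γ x else c x

            boundary : ∀ {x y} → Path p v x → ¬ Path p v y → x ~ y → γ x ≢ c y
            boundary {x} {y} πx ¬πy x~y eq = ¬πy (πx ◅◅ (x~y , trans (sym (path-side πx))
              (trans (sym (γ-side x)) (trans (cong side eq) (sides y)))) ◅ ε)

            proper : ∀ x y → x ~ y → c′ x ≢ c′ y
            proper x y x~y eq with Z? x | Z? y
            ... | yes πx | no ¬πy = boundary πx ¬πy x~y eq
            ... | no ¬πx | yes πy = boundary πy ¬πx (~-sym x~y) (sym eq)
            ... | no ¬πx | no ¬πy = off x y x~y (λ { refl → ¬πx ε }) (λ { refl → ¬πy ε }) eq
            ... | yes πx | yes πy with low? x | low? y
            ...   | yes lx | yes ly = none (x , y , πx , πy , x~y , lx , ly)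
            ...   | yes lx | no  hy = α≢β (trans (sym (γ-low lx)) (trans eq (γ-high hy)))
            ...   | no  hx | yes ly = α≢β (trans (sym (γ-low ly)) (trans (sym eq) (γ-high hx)))
            ...   | no  hx | no  hy = high-independent hx hy x~y

          -- Slots: what a component leaves behind when its vertex `v` moves away.

          Slot : Fin n → (Fin n → Bool) → Fin n → Set
          Slot v p a = a ≢ v × Path p v a

          -- A vertex b of the slot has r s neighbours both in slot + v and in
          -- slot + v′, so it is adjacent to v′ as soon as it is adjacent to v.
          nbrs-transfer : ∀ {v p v′ p′} → Cfg v p → Cfg v′ p′ →
            (∀ {a} → Slot v p a → p′ a ≡ p v) →
            (∀ {a b} → Slot v p a → a ~ b → p′ b ≡ p v → b ≢ v′ → Slot v p b) →
            ∀ {z} → Slot v p z → Path p′ v′ z →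
            ∀ {b} → v ~ b → p b ≡ p v → v′ ~ b
          nbrs-transfer {v} {p} {v′} {p′} cfg cfg′ inside closed {z} Sz π {b} v~b pb
            with last-exit (proj₂ Sz) (proj₁ Sz)
          ... | a , v~a , pa , ρ with adj v′ b Bool.≟ true
          ...   | yes v′~b = v′~b
          ...   | no  v′≁b = contradiction
              (begin-strict
                r (p b)                ≡⟨ cong r (trans pb (sym (inside Sb))) ⟩
                r (p′ b)               ≡⟨ regular cfg′b ⟨
                inDeg p′ b             ≤⟨ #-mono (nbrs p′ b (p′ b)) (nbrs p b (p b) ∖ v) fewer ⟩
                # (nbrs p b (p b) ∖ v) <⟨ ≤-reflexive (sym (#-∖ {P = nbrs p b (p b)} v (∧⁺ (~-sym v~b) (≡⇒same pb)))) ⟩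
                inDeg p b              ≡⟨ regular cfgb ⟩
                r (p b)                ∎)
              (<-irrefl refl)
            where
            open ≤-Reasoning
            Sb : Slot v p b
            Sb = ~⇒≢ (~-sym v~b) , (v~b , sym pb) ◅ ε
            walk : ∀ {x y} → Slot v p x → OffPath p v x y → Path p′ x y
            walk Sx ε = ε
            walk Sx@(_ , πx) (((x~y , eq) , _ , y≢v) ◅ σ) =
              (x~y , trans (inside Sx) (sym (inside Sy))) ◅ walk Sy σ
              where Sy = y≢v , πx ◅◅ (x~y , eq) ◅ ε
            cfgb : Cfg b p
            cfgb = shift* cfg (proj₂ Sb)
            -- In `p′`, `b` is reached from `v′` by going to `z`, back to `a`, and on to `b` by
            -- `linked`, which avoids `v`.
            cfg′b : Cfg b p′
            cfg′b = shift* cfg′ (π ◅◅ walk Sz (offPath-sym ρ ◅◅ linked cfg v~a pa v~b pb))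
            -- If `v′` is not adjacent to `b`, all neighbours of `b` on its side in `p′` lie in the
            -- slot, whereas in `p` there is also `v`.
            fewer : ∀ u → nbrs p′ b (p′ b) u ≡ true → (nbrs p b (p b) ∖ v) u ≡ true
            fewer u eq with ∧⁻ eq
            ... | b~u , su = ∖-keeps {P = nbrs p b (p b)} (∧⁺ b~u (≡⇒same (trans pb (path-side (proj₂ Su))))) (proj₁ Su)
              where
              Su : Slot v p u
              Su = closed Sb b~u (trans (sym (same⇒≡ su)) (inside Sb)) λ { refl → v′≁b (~-sym b~u) }

          -- Moving `v` or `v′` across gives two configurations that agree on the slot of `v`, to
          -- which `v′` is attached through `z`. So `nbrs-transfer` applies.
          shared-slot : ∀ q v v′ → q v ≡ q v′ → Cfg v (flip v q) → Cfg v′ (flip v′ q) →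
            ∀ {z} → Path (flip v q) v z → z ≢ v → v′ ~ z →
            ∀ {b} → q b ≡ not (q v) → v ~ b → v′ ~ b
          shared-slot q v v′ qv cfg cfg′ {z} π z≢v v′~z {b} qb v~b =
            nbrs-transfer {v} {flip v q} {v′} {flip v′ q} cfg cfg′ inside closed (z≢v , π) step v~b
              (trans (flip-off q (~⇒≢ (~-sym v~b))) (trans qb (sym (flip-at v q))))
            where
            opposite : ∀ {a} → Slot v (flip v q) a → q a ≡ not (q v)
            opposite (a≢v , ρ) = trans (sym (flip-off q a≢v)) (trans (sym (path-side ρ)) (flip-at v q))
            ≢v′ : ∀ {a} → q a ≡ not (q v) → a ≢ v′
            ≢v′ qa refl = ≡not⇒≢ qa (sym qv)
            inside : ∀ {a} → Slot v (flip v q) a → flip v′ q a ≡ flip v q v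
            inside S = trans (flip-off q (≢v′ (opposite S))) (trans (opposite S) (sym (flip-at v q)))
            closed : ∀ {a b} → Slot v (flip v q) a → a ~ b → flip v′ q b ≡ flip v q v → b ≢ v′ → Slot v (flip v q) b
            closed S@(a≢v , ρ) a~b qb b≢v′ = b≢v , ρ ◅◅ (a~b , trans (flip-off q a≢v) (trans (opposite S) (trans (sym qb′) (sym (flip-off q b≢v))))) ◅ ε
              where
              qb′ = trans (sym (flip-off q b≢v′)) (trans qb (flip-at v q))
              b≢v = λ { refl → ≡not⇒≢ qb′ refl }
            step : Path (flip v′ q) v′ z
            step = (v′~z , trans (flip-at v′ q) (trans (cong not (sym qv)) (trans (sym (opposite (z≢v , π))) (sym (flip-off q (~⇒≢ (~-sym v′~z))))))) ◅ ε

          -- For the converse the roles are swapped: a neighbour `a` of `v` in the slot is also one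
          -- of `v′`, and now serves as the common vertex.
          shared-nbrs : ∀ q v v′ → q v ≡ q v′ → Cfg v (flip v q) → Cfg v′ (flip v′ q) →
            ∀ {z} → Path (flip v q) v z → z ≢ v → v′ ~ z →
            ∀ {b} → q b ≡ not (q v) → (v ~ b → v′ ~ b) × (v′ ~ b → v ~ b)
          shared-nbrs q v v′ qv cfg cfg′ π z≢v v′~z {b} qb with last-exit π z≢v
          ... | a , v~a , pa , _ = forward qb ,
              shared-slot q v′ v (sym qv) cfg′ cfg ((v′~a , trans (flip-at v′ q) (trans (cong not (sym qv)) (trans (sym qa) (sym (flip-off q (~⇒≢ (~-sym v′~a))))))) ◅ ε)
                (~⇒≢ (~-sym v′~a)) v~a (trans qb (cong not qv))
            where
            forward : ∀ {b} → q b ≡ not (q v) → v ~ b → v′ ~ b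
            forward = shared-slot q v v′ qv cfg cfg′ π z≢v v′~z
            qa : q a ≡ not (q v)
            qa = trans (sym (flip-off q (~⇒≢ (~-sym v~a)))) (trans pa (flip-at v q))
            v′~a : v′ ~ a
            v′~a = forward qa v~a

          -- Pairs of low vertices with a common low neighbour across.

          record Triple (p : Fin n → Bool) (y y′ w : Fin n) : Set where
            field
              cfg    : Cfg y p
              path   : Path p y y′
              y≢y′   : y ≢ y′
              low-y  : Low y
              low-y′ : Low y′
              low-w  : Low w
              across : p w ≡ not (p y)
              y~w    : y ~ w
              y′~w   : y′ ~ w

            -- Whichever of `y` and `y′` crosses meets `w`, so both attach to the same slot.
            opposite-nbrs : ∀ {b} → p b ≡ not (p y) → (y ~ b → y′ ~ b) × (y′ ~ b → y ~ b)
            opposite-nbrs = shared-nbrs p y y′ (path-side path) (low-flip low-y cfg) (low-flip low-y′ (shift* cfg path))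
              ((y~w , trans (flip-at y p) (trans (sym across) (sym (flip-off p (~⇒≢ (~-sym y~w)))))) ◅ ε)
              (~⇒≢ (~-sym y~w)) y′~w

            flipped-side : flip y p y ≡ flip y p w
            flipped-side = trans (flip-at y p) (trans (sym across) (sym (flip-off p (~⇒≢ (~-sym y~w)))))

            -- After `y` has crossed, `y` and `w` are on one side and are compared in the same way,
            -- with `y′` as the common vertex.
            own-nbrs : ∀ {b} → b ≢ y → p b ≡ p y → (y ~ b → w ~ b) × (w ~ b → y ~ b)
            own-nbrs {b} b≢y pb = shared-nbrs (flip y p) y w flipped-side
              (cfg-cong (λ x → sym (flip-flip y p x)) cfg)
              (low-flip low-w (shift (low-flip low-y cfg) y~w (sym flipped-side)))
              (path-cong (λ x → sym (flip-flip y p x)) path) (y≢y′ ∘ sym) (~-sym y′~w)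
              (trans (flip-off p b≢y) (trans pb (sym (trans (cong not (flip-at y p)) (not-involutive (p y))))))

            y~y′ : y ~ y′
            y~y′ = proj₂ (own-nbrs (y≢y′ ∘ sym) (sym (path-side path))) (~-sym y′~w)

          open Triple

          exchange : ∀ {p y y′ w} → Triple p y y′ w → Triple p y′ y w
          exchange T = record
            { cfg = shift* (cfg T) (path T) ; path = path-sym (path T) ; y≢y′ = y≢y′ T ∘ sym
            ; low-y = low-y′ T ; low-y′ = low-y T ; low-w = low-w T
            ; across = trans (across T) (cong not (path-side (path T))) ; y~w = y′~w T ; y′~w = y~w T }

          -- With `y` moved across, `w` and `y′` trade roles. Together with `exchange` this permits
          -- every permutation of the three vertices.
          turn : ∀ {p y y′ w} → Triple p y y′ w → Triple (flip y p) y w y′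
          turn {p} {y} {y′} {w} T = record
            { cfg = low-flip (low-y T) (cfg T) ; path = (y~w T , flipped-side T) ◅ ε ; y≢y′ = ~⇒≢ (y~w T)
            ; low-y = low-y T ; low-y′ = low-w T ; low-w = low-y′ T
            ; across = trans (flip-off p (y≢y′ T ∘ sym)) (trans (sym (path-side (path T)))
                (sym (trans (cong not (flip-at y p)) (not-involutive (p y)))))
            ; y~w = y~y′ T ; y′~w = ~-sym (y′~w T) }

          -- On the side of `y` the comparison passes through `w`.
          twins-y′ : ∀ {p y y′ w} → Triple p y y′ w → Twins y y′
          twins-y′ {p} {y} T z z≢y z≢y′ with p z Bool.≟ p y
          ... | no pz = opposite-nbrs T (¬-not pz)
          ... | yes pz = proj₂ y′⇔w ∘ proj₁ y⇔w , proj₂ y⇔w ∘ proj₁ y′⇔w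
            where
            y⇔w = own-nbrs T z≢y pz
            y′⇔w = own-nbrs (exchange T) z≢y′ (trans pz (path-side (path T)))

          -- On the side of `w` the comparison passes through `y′`.
          twins-w : ∀ {p y y′ w} → Triple p y y′ w → Twins y w
          twins-w {p} {y} {y′} {w} T z z≢y z≢w with p z Bool.≟ p y
          ... | yes pz = own-nbrs T z≢y pz
          ... | no pz = proj₂ w⇔y′ ∘ proj₁ y⇔y′ , proj₂ y⇔y′ ∘ proj₁ w⇔y′
            where
            y⇔y′ = opposite-nbrs T (¬-not pz)
            w⇔y′ = own-nbrs (exchange (turn T)) z≢w
              (trans (flip-off p z≢y) (trans (¬-not pz) (trans (sym (flip-at y p)) (flipped-side T))))

          -- `t` can replace `y′` or `w` in the triple, depending on its side.
          low-twins : ∀ {p y y′ w} → Triple p y y′ w → ∀ {t} → Low t → y ~ t → Twins y t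
          low-twins {p} {y} {y′} {w} T {t} low y~t with p t Bool.≟ p y
          ... | yes pt = twins-y′ {p} {w = w} record
            { cfg = cfg T ; path = (y~t , sym pt) ◅ ε ; y≢y′ = ~⇒≢ y~t ; low-y = low-y T ; low-y′ = low ; low-w = low-w T
            ; across = across T ; y~w = y~w T ; y′~w = ~-sym (proj₁ (own-nbrs T (~⇒≢ (~-sym y~t)) pt) y~t) }
          ... | no pt = twins-w {p} {y′ = y′} record
            { cfg = cfg T ; path = path T ; y≢y′ = y≢y′ T ; low-y = low-y T ; low-y′ = low-y′ T ; low-w = low
            ; across = ¬-not pt ; y~w = y~t ; y′~w = proj₁ (opposite-nbrs T (¬-not pt)) y~t }

          triple⇒clique : 5 ≤ K → ∀ {p y y′ w} → Triple p y y′ w → Clique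
          triple⇒clique 5≤K T = Neighbourhood.clique 5≤K (low-y T) (low-twins T)
            (y~y′ T) (y~w T) (low-y′ T) (low-w T) (~⇒≢ (y′~w T))

          -- The walk never meets an earlier component again.

          -- At time t the vertex V t is uncoloured and counted on its side of P t;
          -- V (suc t) then leaves its component, where X t stays behind.
          module Wandering (no-triple : ∀ {p y y′ w} → ¬ Triple p y y′ w)
            (V X : ℕ → Fin n) (P : ℕ → Fin n → Bool)
            (cfg     : ∀ t → Cfg (V t) (P t))
            (P-suc   : ∀ t → P (suc t) ≗ flip (V (suc t)) (P t))
            (V-moves : ∀ t → V (suc t) ≢ V t)
            (V-path  : ∀ t → Path (P t) (V t) (V (suc t)))
            (X-path  : ∀ t → Path (P t) (V t) (X t))
            (V~X     : ∀ t → V (suc t) ~ X t)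
            (V-low   : ∀ t → Low (V (suc t)))
            (X-low   : ∀ t → Low (X t))
            where

            D : ℕ → Fin n → Set
            D t = Path (P t) (V t)

            s : ℕ → Bool
            s t = P t (V t)

            P-at : ∀ t → P (suc t) (V (suc t)) ≡ not (P t (V (suc t)))
            P-at t = trans (P-suc t (V (suc t))) (flip-at (V (suc t)) (P t))

            P-away : ∀ {t z} → z ≢ V (suc t) → P (suc t) z ≡ P t z
            P-away {t} {z} z≢V = trans (P-suc t z) (flip-off (P t) z≢V)

            P-unflip : ∀ t → P t ≗ flip (V (suc t)) (P (suc t))
            P-unflip t z with z ≟ V (suc t)
            ... | yes refl = sym (trans (flip-at (V (suc t)) (P (suc t))) (trans (cong not (P-at t)) (not-involutive _)))
            ... | no z≢V   = sym (trans (flip-off (P (suc t)) z≢V) (P-away z≢V))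

            s-suc : ∀ t → s (suc t) ≡ not (s t)
            s-suc t = trans (P-at t) (cong not (sym (path-side (V-path t))))

            Unmoved : ℕ → ℕ → Fin n → Set
            Unmoved i j z = ∀ m → i < m → m ≤ j → z ≢ V m

            unmoved : ∀ {i} j {z} → i ≤ j → Unmoved i j z → P j z ≡ P i z
            unmoved zero z≤n _ = refl
            unmoved {i} (suc j) i≤1+j still with m≤n⇒m<n∨m≡n i≤1+j
            ... | inj₂ refl = refl
            ... | inj₁ i<1+j = trans (P-away (still (suc j) i<1+j ≤-refl))
              (unmoved j (≤-pred i<1+j) λ m i<m m≤j → still m i<m (m≤n⇒m≤1+n m≤j))

            moved? : ∀ i j z → Unmoved i j z ⊎ (∃[ m ] i < m × m ≤ j × z ≡ V m)
            moved? i zero z = inj₁ λ { _ i<m z≤n _ → contradiction i<m λ () }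
            moved? i (suc j) z with moved? i j z
            ... | inj₂ (m , i<m , m≤j , z≡V) = inj₂ (m , i<m , m≤n⇒m≤1+n m≤j , z≡V)
            ... | inj₁ still with z ≟ V (suc j) | i Nat.<? suc j
            ...   | yes z≡V | yes i<1+j = inj₂ (suc j , i<1+j , ≤-refl , z≡V)
            ...   | yes z≡V | no i≮1+j  = inj₁ λ m i<m m≤1+j _ → i≮1+j (≤-trans i<m m≤1+j)
            ...   | no z≢V  | _         = inj₁ λ m i<m m≤1+j → further m i<m (m≤n⇒m<n∨m≡n m≤1+j)
              where
              further : ∀ m → i < m → m < suc j ⊎ m ≡ suc j → z ≢ V m
              further m i<m (inj₁ m<1+j) = still m i<m (≤-pred m<1+j)
              further m i<m (inj₂ refl)  = z≢V

            -- The exception is forced: `V (suc i)` lies both in the component that it leaves and in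
            -- the one that it enters.
            Apart : ℕ → Set
            Apart j = ∀ i → i < j → ∀ z → D i z → D j z → j ≡ suc i × z ≡ V j

            apart-distinct : ∀ {j} → Apart j → ∀ {i} → i < j → V i ≢ V j
            apart-distinct {j} apart {i} i<j eq with apart i i<j (V i) ε (subst (D j) (sym eq) ε)
            ... | refl , _ = V-moves i (sym eq)

            module NoReturn (t : ℕ) (ih : ∀ j → j ≤ t → Apart j) where

              distinct : ∀ {i j} → i < j → j ≤ t → V i ≢ V j
              distinct i<j j≤t = apart-distinct (ih _ j≤t) i<j

              -- If `z` moved as `V m`, it would lie in both `D i` and `D m`, so `Apart m` would
              -- make it `V (suc i)`.
              settled : ∀ {i j z} → D i z → z ≢ V (suc i) → i ≤ j → j ≤ t → P j z ≡ P i z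
              settled {i} {j} {z} Dz z≢V i≤j j≤t = unmoved j i≤j still
                where
                still : Unmoved i j z
                still m i<m m≤j refl with ih m (≤-trans m≤j j≤t) i i<m z Dz ε
                ... | refl , _ = z≢V refl

              after : ∀ {m j} → m ≤ j → j ≤ t → P j (V m) ≡ s m
              after {m} {j} m≤j j≤t = unmoved j m≤j λ m′ m<m′ m′≤j → distinct m<m′ (≤-trans m′≤j j≤t)

              -- The vertices `V` up to time `t` are distinct, so each of them changes sides only
              -- once.
              before : ∀ {i m} → i < m → m ≤ t → P i (V m) ≡ not (s m)
              before {i} {suc m} i<1+m m≤t = sym (trans (cong not (P-at m)) (trans (not-involutive _)
                (unmoved m (≤-pred i<1+m) λ m′ _ m′≤m eq → distinct (s≤s m′≤m) m≤t (sym eq))))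

              -- If `b` has not moved since time `i`, it was already in `D i`. If it moved as `V m`,
              -- then `a` would lie in `D m` and in `D i`, and so be `V (suc i)`.
              slot-closed : ∀ {i j a b} → D i a → a ≢ V (suc i) → i < j → j ≤ t →
                            a ~ b → P j b ≡ s i → D i b × b ≢ V (suc i)
              slot-closed {i} {j} {a} {b} Da a≢V i<j j≤t a~b Pb with moved? i j b
              ... | inj₁ still = Da ◅◅ (a~b , trans (sym (path-side Da)) (trans (sym Pb) (unmoved j (<⇒≤ i<j) still))) ◅ ε ,
                                 still (suc i) ≤-refl i<j
              ... | inj₂ (m , i<m , m≤j , refl) with ih m (≤-trans m≤j j≤t) i i<m a Da
                      ((~-sym a~b , trans (sym (after m≤j j≤t)) (trans Pb (trans (path-side Da)
                        (sym (settled Da a≢V (<⇒≤ i<m) (≤-trans m≤j j≤t)))))) ◅ ε)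
              ...   | refl , a≡V = contradiction a≡V a≢V

              new∉ : ∀ {i} → i < t → ¬ D i (V (suc t))
              new∉ {i} i<t D-new = V-moves t (proj₂ (ih t ≤-refl i i<t _ D-new (V-path t)))

              new-distinct : ∀ {m} → m ≤ t → V (suc t) ≢ V m
              new-distinct m≤t eq with m≤n⇒m<n∨m≡n m≤t
              ... | inj₁ m<t  = new∉ m<t (subst (D _) (sym eq) ε)
              ... | inj₂ refl = V-moves t eq

              -- Suppose that the walk comes back to `D i` at `z`. Then `V (suc t)` fills the slot
              -- left by `V (suc i)` and is adjacent to `X i`. Comparing these two across shows that
              -- `X i` is adjacent to `X t`, and the three form a triple.
              module Return {i z} (i<t : i < t) (Dz : D i z) (z≢V : z ≢ V (suc i)) (D-new-z : D (suc t) z) where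

                settled′ : ∀ {a} → D i a → a ≢ V (suc i) → P (suc t) a ≡ s i
                settled′ Da a≢V = trans (P-away λ { refl → new∉ i<t Da })
                  (trans (settled Da a≢V (<⇒≤ i<t) ≤-refl) (sym (path-side Da)))

                si≡sj : s i ≡ s (suc t)
                si≡sj = trans (sym (settled′ Dz z≢V)) (sym (path-side D-new-z))

                st≡ : s t ≡ not (s i)
                st≡ = trans (sym (not-involutive (s t))) (cong not (sym (trans si≡sj (s-suc t))))

                x = X i

                x≢V : x ≢ V (suc i)
                x≢V = ~⇒≢ (~-sym (V~X i))

                slot⇒D : ∀ {a} → Slot (V (suc i)) (P i) a → D i a
                slot⇒D (_ , π) = V-path i ◅◅ π

                D⇒slot : ∀ {a} → D i a × a ≢ V (suc i) → Slot (V (suc i)) (P i) a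
                D⇒slot (π , a≢V) = a≢V , path-sym (V-path i) ◅◅ π

                Pi-V : P i (V (suc i)) ≡ s i
                Pi-V = sym (path-side (V-path i))

                new~x : V (suc t) ~ x
                new~x = nbrs-transfer {V (suc i)} {P i} {V (suc t)} {P (suc t)}
                  (shift* (cfg i) (V-path i)) (cfg (suc t))
                  (λ S → trans (settled′ (slot⇒D S) (proj₁ S)) (sym Pi-V))
                  (λ S a~b Pb b≢new → D⇒slot (slot-closed (slot⇒D S) (proj₁ S) i<t ≤-refl a~b
                    (trans (sym (P-away b≢new)) (trans Pb Pi-V))))
                  (D⇒slot (Dz , z≢V)) D-new-z (V~X i) (trans (sym (path-side (X-path i))) (sym Pi-V))

                -- At time `i` the low vertex `x` could have crossed instead. There it meets
                -- `V (suc t)`, which at that time is on the side opposite to `s i`.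
                q = flip x (P i)

                cfg-x : Cfg x q
                cfg-x = low-flip (X-low i) (shift* (cfg i) (X-path i))

                qx : q x ≡ not (s i)
                qx = trans (flip-at x (P i)) (cong not (sym (path-side (X-path i))))

                Pi-new : P i (V (suc t)) ≡ not (s i)
                Pi-new = trans (sym (unmoved t (<⇒≤ i<t) λ m _ m≤t → new-distinct m≤t))
                  (trans (sym (path-side (V-path t))) st≡)

                q-new : q (V (suc t)) ≡ q x
                q-new = trans (flip-off (P i) (~⇒≢ new~x)) (trans Pi-new (sym qx))

                Q = nbrs q x (q x)

                -- Each side has at least two colours, so by `regular` `x` has a second neighbour on
                -- its new side.
                another : ∃[ b ] (Q ∖ V (suc t)) b ≡ true
                another = #-inhabited (Q ∖ V (suc t)) (≤-pred (≤-trans (2≤r (q x))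
                  (≤-reflexive (trans (sym (regular cfg-x)) (#-∖ (V (suc t)) (∧⁺ (~-sym new~x) (≡⇒same (sym q-new))))))))

                b = proj₁ another

                b≢new : b ≢ V (suc t)
                b≢new = ∖-drops {P = Q} (proj₂ another)

                b∈ : x ~ b × same (q x) (q b) ≡ true
                b∈ = ∧⁻ (∖-⊆ {P = Q} (proj₂ another))

                -- Between times i and t no move touched the slot of V (suc t):
                -- otherwise D t would meet an earlier component.
                carry : ∀ {a c} → OffPath q x a c → D t a → P i a ≡ not (s i) → D t c
                carry ε Da _ = Da
                carry (_◅_ {a} {c} ((a~c , qa≡qc) , a≢x , c≢x) π) Da Pia = carry π (Dc (moved? i t c) (moved? i t a)) Pic
                  where
                  Pic : P i c ≡ not (s i)
                  Pic = trans (sym (flip-off (P i) c≢x)) (trans (sym qa≡qc) (trans (flip-off (P i) a≢x) Pia))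
                  Dc : Unmoved i t c ⊎ (∃[ m ] i < m × m ≤ t × c ≡ V m) →
                       Unmoved i t a ⊎ (∃[ m ] i < m × m ≤ t × a ≡ V m) → D t c
                  Dc (inj₁ still) _ = Da ◅◅ (a~c , trans (sym (path-side Da)) (trans st≡ (trans (sym Pic) (sym (unmoved t (<⇒≤ i<t) still))))) ◅ ε
                  -- `a` is on the same side at times `i` and `t`, but a vertex that moved in
                  -- between changed sides exactly once.
                  Dc (inj₂ _) (inj₂ (m , i<m , m≤t , a≡V)) = contradiction
                    (trans (sym (subst (λ a → P t a ≡ s m) (sym a≡V) (after m≤t ≤-refl))) (trans (sym (path-side Da)) (trans st≡ (trans (sym Pia)
                      (subst (λ a → P i a ≡ not (s m)) (sym a≡V) (before i<m m≤t))))))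
                    (not-¬ refl)
                  -- Just before `c` moved as `V (suc m)`, `a` was in its component `D m`. As `a` is
                  -- also in `D t`, `ih` forces `a` to be `V t`, which is `c` itself.
                  Dc (inj₂ (suc m , i<1+m , m<t , c≡V)) (inj₁ still) = ⊥-elim (~⇒≢ a~c (trans a≡Vt (trans (cong V t≡1+m) (sym c≡V))))
                    where
                    Pi-V′ : P i (V (suc m)) ≡ not (s i)
                    Pi-V′ = subst (λ c → P i c ≡ not (s i)) c≡V Pic
                    sm≡ : s m ≡ not (s i)
                    sm≡ = trans (sym (not-involutive (s m))) (trans (cong not (sym (s-suc m))) (trans (sym (before i<1+m m<t)) Pi-V′))
                    Pma : P m a ≡ not (s i)
                    Pma = trans (unmoved m (≤-pred i<1+m) λ m′ i<m′ m′≤m → still m′ i<m′ (≤-trans m′≤m (<⇒≤ m<t))) Pia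
                    Dma : D m a
                    Dma = V-path m ◅◅ (~-sym (subst (a ~_) c≡V a~c) , trans (sym (path-side (V-path m))) (trans sm≡ (sym Pma))) ◅ ε
                    again = ih t ≤-refl m m<t a Dma Da
                    t≡1+m = proj₁ again
                    a≡Vt = proj₂ again

                D-b : D t b
                D-b = carry (linked cfg-x (~-sym new~x) q-new (proj₁ b∈) (sym (same⇒≡ (proj₂ b∈)))) (V-path t) Pi-new

                new-x : s (suc t) ≡ P (suc t) x
                new-x = trans (sym si≡sj) (sym (settled′ (X-path i) x≢V))

                P-w : P (suc t) (X t) ≡ not (s (suc t))
                P-w = trans (P-away (~⇒≢ (~-sym (V~X t)))) (trans (sym (path-side (X-path t)))
                  (trans (sym (not-involutive (s t))) (cong not (sym (s-suc t)))))

                -- At time `suc t` both `V (suc t)` and `x` can cross to the slot in `D t`, to which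
                -- `x` is attached through `b`. So `x` shares the neighbour `X t`.
                x~w : x ~ X t
                x~w = shared-slot (P (suc t)) (V (suc t)) x new-x
                  (cfg-cong (P-unflip t) (shift* (cfg t) (V-path t)))
                  (low-flip (X-low i) (shift (cfg (suc t)) new~x (sym new-x)))
                  (path-cong (P-unflip t) (path-sym (V-path t) ◅◅ D-b)) b≢new (proj₁ b∈) P-w (V~X t)

                triple : Triple (P (suc t)) (V (suc t)) x (X t)
                triple = record
                  { cfg = cfg (suc t) ; path = (new~x , new-x) ◅ ε ; y≢y′ = ~⇒≢ new~x
                  ; low-y = V-low t ; low-y′ = X-low i ; low-w = X-low t
                  ; across = P-w ; y~w = V~X t ; y′~w = x~w }

              no-return : ∀ {i z} → i < t → D i z → z ≢ V (suc i) → ¬ D (suc t) z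
              no-return i<t Dz z≢V D-new-z = no-triple (Return.triple i<t Dz z≢V D-new-z)

              -- Successive components lie on opposite sides, so a common vertex must have just
              -- moved.
              successive : ∀ {z} → D t z → D (suc t) z → z ≡ V (suc t)
              successive {z} Dz D-new-z with z ≟ V (suc t)
              ... | yes z≡V = z≡V
              ... | no z≢V  = contradiction (trans (path-side Dz) (trans (sym (P-away z≢V)) (trans (sym (path-side D-new-z)) (s-suc t))))
                                            (not-¬ refl)

              apart-suc : Apart (suc t)
              apart-suc i i<1+t z Dz D-new-z with m≤n⇒m<n∨m≡n (≤-pred i<1+t)
              ... | inj₂ refl = refl , successive Dz D-new-z
              ... | inj₁ i<t with z ≟ V (suc i)
              ...   | no z≢V = contradiction D-new-z (no-return i<t Dz z≢V)
              ...   | yes refl with m≤n⇒m<n∨m≡n i<t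
              -- `V (suc i)` also lies in its own component `D (suc i)`, to which `no-return`
              -- applies instead.
              ...     | inj₁ 1+i<t = contradiction D-new-z (no-return 1+i<t ε (V-moves (suc i) ∘ sym))
              ...     | inj₂ refl  = contradiction (sym (successive ε D-new-z)) (V-moves t)

            apart : ∀ j → Apart j
            apart = <-rec Apart λ { zero _ _ () ; (suc t) ih → NoReturn.apart-suc t λ j j≤t → ih (s≤s j≤t) }

            absurd : ⊥
            absurd with pigeonhole (n<1+n n) (V ∘ toℕ)
            ... | i , j , i<j , eq = apart-distinct (apart (toℕ j)) i<j eq

          -- Construction of the walk.

          record State : Set where
            field
              vertex    : Fin n
              partition : Fin n → Bool
              cfg       : Cfg vertex partition

          open State

          record Move (S : State) : Set where
            field
              to to-nbr : Fin n
              moves     : to ≢ vertex S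
              to-path   : Path (partition S) (vertex S) to
              nbr-path  : Path (partition S) (vertex S) to-nbr
              to~nbr    : to ~ to-nbr
              to-low    : Low to
              nbr-low   : Low to-nbr

          open Move

          -- Of the two ends of a low edge in the component, one that is not the uncoloured vertex
          -- moves and the other stays behind.
          move : ∀ S → Move S
          move S with low-edge (cfg S)
          ... | a , b , πa , πb , a~b , la , lb with a ≟ vertex S
          ...   | no a≢v = record
            { moves = a≢v ; to-path = πa ; nbr-path = πb ; to~nbr = a~b ; to-low = la ; nbr-low = lb }
          ...   | yes refl = record
            { moves = ~⇒≢ (~-sym a~b) ; to-path = πb ; nbr-path = πa ; to~nbr = ~-sym a~b ; to-low = lb ; nbr-low = la }

          no-cfg : (∀ {p y y′ w} → ¬ Triple p y y′ w) → ∀ {v p} → ¬ Cfg v p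
          no-cfg no-triple {v} {p} start = Wandering.absurd no-triple (vertex ∘ walk) (to-nbr ∘ moved) (partition ∘ walk)
            (cfg ∘ walk) (λ _ _ → refl) (moves ∘ moved) (to-path ∘ moved) (nbr-path ∘ moved) (to~nbr ∘ moved)
            (to-low ∘ moved) (nbr-low ∘ moved)
            where
            next : State → State
            next S = record
              { vertex    = to (move S)
              ; partition = flip (to (move S)) (partition S)
              ; cfg       = low-flip (to-low (move S)) (shift* (cfg S) (to-path (move S)))
              }
            walk : ℕ → State
            walk zero    = record { cfg = start }
            walk (suc t) = next (walk t)
            moved : ∀ t → Move (walk t)
            moved t = move (walk t)

        -- Strong induction on the weight stands in for choosing a minimum: when no smaller weight
        -- occurs, `Φ p` is minimal over all `v` and `p`.
        no-pre : 5 ≤ K → ¬ Clique → ∀ {v p} → ¬ Pre v p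
        no-pre 5≤K no-clique {v} {p} pre = <-rec Goal descend (Φ p) pre refl
          where
          Goal : ℕ → Set
          Goal m = ∀ {v p} → Pre v p → Φ p ≢ m
          descend : ∀ m → (∀ {m′} → m′ < m → Goal m′) → Goal m
          descend m ih pre Φ≡m = no-cfg (no-clique ∘ triple⇒clique 5≤K) (pre , Φ≡m)
            where open Minimal m (λ pre → ≮⇒≥ λ Φ<m → ih Φ<m pre refl)

-- Reduction to critical subgraphs.

two-on-each-side : ∀ {K} → 4 ≤ K → ∃ λ (side : Fin K → Bool) →
                   ∀ s → ∃[ α ] ∃[ β ] α ≢ β × side α ≡ s × side β ≡ s
two-on-each-side (s≤s (s≤s (s≤s (s≤s _)))) = side , two
  where
  side : ∀ {K} → Fin K → Bool
  side zero          = true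
  side (suc zero)    = true
  side (suc (suc _)) = false
  two : ∀ s → ∃[ α ] ∃[ β ] α ≢ β × side α ≡ s × side β ≡ s
  two true  = zero , suc zero , (λ ()) , refl , refl
  two false = suc (suc zero) , suc (suc (suc zero)) , (λ ()) , refl , refl

#-punchIn : (P : Fin (suc n) → Bool) (v : Fin (suc n)) → # (P ∘ punchIn v) ≤ # P
#-punchIn P v = ≤-trans (m≤n+m _ (bit (P v))) (≤-reflexive (sym (sum-remove {i = v} (bit ∘ P))))

-- Makes `colourable?` available for Boolean adjacency.
toGraph : (adj : Fin n → Fin n → Bool) → (∀ x y → adj x y ≡ adj y x) → (∀ x → adj x x ≡ false) → Graph
toGraph {n} adj adj-sym adj-irr = record
  { order  = n
  ; Adj    = λ x y → adj x y ≡ true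
  ; adj?   = λ x y → adj x y Bool.≟ true
  ; symm   = λ {x} {y} x~y → trans (adj-sym y x) x~y
  ; irrefl = λ { {x} refl x~x → contradiction (trans (sym x~x) (adj-irr x)) λ () }
  }

-- Induction on the order: either some vertex can be deleted without making the graph colourable,
-- and the Ore bound survives as degrees do not grow, or the graph is critical. The double negation
-- comes from refuting `¬ Clique`.
clique-exists : ∀ n {K} (adj : Fin n → Fin n → Bool)
  (adj-sym : ∀ x y → adj x y ≡ adj y x) (adj-irr : ∀ x → adj x x ≡ false) →
  let open Critical {K = K} adj adj-sym adj-irr in
  5 ≤ K → Uncolourable → (∀ {x y} → x ~ y → deg x + deg y ≤ suc (K + K)) → ¬ ¬ Clique
clique-exists zero    adj adj-sym adj-irr 5≤K uncol ore no-clique = uncol ((λ ()) , λ ())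
clique-exists (suc n) {K} adj adj-sym adj-irr 5≤K@(s≤s _) uncol ore no-clique =
  no-pre 5≤K no-clique (proj₁ (critical zero) , proj₂ (critical zero) , λ _ → refl)
  where
  open Critical {K = K} adj adj-sym adj-irr
  delete : Fin (suc n) → Fin n → Fin n → Bool
  delete v x y = adj (punchIn v x) (punchIn v y)
  critical : ∀ v → ∃ (ProperOff v)
  critical v with Graph.colourable? (toGraph (delete v) (λ _ _ → adj-sym _ _) (λ _ → adj-irr _)) K
  ... | no uncol′ = ⊥-elim (clique-exists n (delete v) (λ _ _ → adj-sym _ _) (λ _ → adj-irr _) 5≤K uncol′
          (λ {x} {y} x~y → ≤-trans (+-mono-≤ (#-punchIn (adj (punchIn v x)) v) (#-punchIn (adj (punchIn v y)) v)) (ore x~y))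
          λ (f , pairwise) → no-clique (punchIn v ∘ f , pairwise))
  ... | yes (c , proper) = c′ , λ x y x~y x≢v y≢v eq →
          proper (punchOut (x≢v ∘ sym)) (punchOut (y≢v ∘ sym))
            (subst₂ _~_ (sym (punchIn-punchOut _)) (sym (punchIn-punchOut _)) x~y)
            (trans (c≡ x≢v) (trans eq (sym (c≡ y≢v))))
    where
    -- The colour `zero` at `v` is junk, as `ProperOff` permits.
    c′ : Fin (suc n) → Fin K
    c′ = insertAt c v zero
    c≡ : ∀ {x} (x≢v : x ≢ v) → c (punchOut (x≢v ∘ sym)) ≡ c′ x
    c≡ x≢v = trans (sym (insertAt-punchIn c v zero _)) (cong c′ (punchIn-punchOut (x≢v ∘ sym)))
  halves = two-on-each-side (≤-trans (n≤1+n 4) 5≤K)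
  open Sides uncol critical ore (proj₁ halves) (proj₂ halves)

-- Translation from the graph to Boolean adjacency.

length-filter-tabulate : {A : Set} {P : A → Set} (P? : ∀ x → Dec (P x)) (f : Fin n → A) →
                         length (filter P? (tabulate f)) ≡ # (does ∘ P? ∘ f)
length-filter-tabulate {zero}  P? f = refl
length-filter-tabulate {suc n} P? f with does (P? (f zero))
... | true  = cong suc (length-filter-tabulate P? (f ∘ suc))
... | false = length-filter-tabulate P? (f ∘ suc)

-- With `K` the rounded half of `θ G`, this turns the Ore-degree into the bound `suc (K + K)`.
n≤1+⌊n/2⌋+⌊n/2⌋ : ∀ n → n ≤ suc (⌊ n /2⌋ + ⌊ n /2⌋)
n≤1+⌊n/2⌋+⌊n/2⌋ zero          = z≤n
n≤1+⌊n/2⌋+⌊n/2⌋ (suc zero)    = s≤s z≤n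
n≤1+⌊n/2⌋+⌊n/2⌋ (suc (suc n)) = s≤s (≤-trans (s≤s (n≤1+⌊n/2⌋+⌊n/2⌋ n)) (≤-reflexive (cong suc (sym (+-suc _ _)))))

module _ (G : Graph) where
  open Graph G

  edgeOreDegree≤θ : ∀ {x y} → Adj x y → edgeOreDegree x y ≤ θ G
  edgeOreDegree≤θ {x} {y} xy = All.lookup (xs≤max 0 (map (uncurry edgeOreDegree) edges))
    (∈-map⁺ (uncurry edgeOreDegree) (∈-filter⁺ (uncurry adj?) (∈-cartesianProduct⁺ (∈-allFin x) (∈-allFin y)) xy))

  χ≤order : χ G ≤ order
  χ≤order = min≤⊤ order (filter colourable? (upTo order))

  χ-least : ∀ {k} → k < χ G → ¬ Colourable k
  χ-least {k} k<χ colouring = <⇒≱ k<χ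
    (All.lookup (min≤xs order (filter colourable? (upTo order)))
      (∈-filter⁺ colourable? (∈-upTo⁺ (≤-trans k<χ χ≤order)) colouring))

  -- Decidability removes the double negation left by `clique-exists`. The search runs over codes of
  -- all maps; a map with adjacent images is injective by irreflexivity.
  complete⊑? : ∀ k → Dec (complete k ⊑ G)
  complete⊑? k = map′ fromCode toCode
    (any? λ i → all? λ x → all? λ y → ¬? (x ≟ y) →-dec adj? (finToFun i x) (finToFun i y))
    where
    Clique : (Fin k → Vertex) → Set
    Clique f = ∀ x y → x ≢ y → Adj (f x) (f y)
    fromCode : ∃ (λ (i : Fin (order ^ k)) → Clique (finToFun i)) → complete k ⊑ G
    fromCode (i , clique) = finToFun i , injective , clique
      where
      injective : ∀ {x y} → finToFun i x ≡ finToFun i y → x ≡ y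
      injective {x} {y} eq with x ≟ y
      ... | yes x≡y = x≡y
      ... | no  x≢y = contradiction (clique x y x≢y) (irrefl eq)
    toCode : complete k ⊑ G → ∃ (λ (i : Fin (order ^ k)) → Clique (finToFun i))
    toCode (f , _ , clique) = funToFin f , λ x y x≢y →
      subst₂ Adj (sym (finToFun-funToFin f x)) (sym (finToFun-funToFin f y)) (clique x y x≢y)

corollaryO : (G : Graph) → 6 ≤ χ G → χ G ≡ ⌊ θ G /2⌋ + 1 → complete (χ G) ⊑ G
corollaryO G 6≤χ χ≡ = decidable-stable (complete⊑? G (χ G)) λ none →
  clique-exists order adj
    (λ x y → does-⇔ (mk⇔ symm symm) (adj? x y) (adj? y x))
    (λ x → dec-false (adj? x x) (irrefl refl))
    (≤-pred (subst (6 ≤_) χ≡1+K 6≤χ))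
    (λ (c , proper) → χ-least G (≤-reflexive (sym χ≡1+K)) (c , λ x y xy → proper x y (dec-true (adj? x y) xy)))
    (λ {x} {y} x~y → ≤-trans (≤-reflexive (cong₂ _+_ (sym (degree≡ x)) (sym (degree≡ y))))
      (≤-trans (edgeOreDegree≤θ G (adjacent x~y)) (n≤1+⌊n/2⌋+⌊n/2⌋ (θ G))))
    λ (f , pairwise) → none (subst (λ k → complete k ⊑ G) (sym χ≡1+K) (f ,
      (λ {i} {j} eq → decidable-stable (i ≟ j) λ i≢j → irrefl eq (adjacent (pairwise i j i≢j))) ,
      λ i j i≢j → adjacent (pairwise i j i≢j)))
  where
  open Graph G
  adj : Vertex → Vertex → Bool
  adj x y = does (adj? x y)
  adjacent : ∀ {x y} → adj x y ≡ true → Adj x y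
  adjacent {x} {y} x~y with yes xy ← adj? x y = xy
  degree≡ : ∀ x → degree x ≡ # (adj x)
  degree≡ x = length-filter-tabulate (adj? x) id
  χ≡1+K : χ G ≡ suc ⌊ θ G /2⌋
  χ≡1+K = trans χ≡ (+-comm _ 1)
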